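{- Let $1\le k<n$ be integers and let $(s_1,\ldots,s_k)$ be a non-decreasing sequence of integers with $l\le s_l<n$ for every $1\le l\le k$. Put $t_l:=s_l-l+1$ for $1\le l\le k$. Then the probability of success of the policy associated with $(s_1,\ldots,s_k)$ is equal to $$-\sum_{i=0}^{k-1}\left(\prod_{j=1}^i t_j\right)d_i(t_{i+1})-\left(\prod_{j=1}^k t_j\right)\delta_{k,n},$$ where the empty product is $1$, $$\delta_{k,n}:=\begin{cases}-\frac{1}{n}\sum_{j=1}^{n-1}\frac{1}{j},& k=1,\\[4pt] \frac{(n-k)!}{n!},& k>1,\end{cases}$$ and for $0\le l\le k$ the map $d_l\colon\{1,\ldots,n-l\}\to\mathbb{R}$ is $$d_l(x):=\begin{cases}-1+\frac{kx}{n}+\frac{\binom{n-x-1}{k}}{\binom{n}{k}}+\frac{x}{\binom{n}{k}}\sum_{j=1}^{x}\frac{\binom{n-j-1}{k-1}}{j},& l=0,\\[6pt] -\frac{k}{n}-\frac{1}{\binom{n}{k}}\sum_{j=1}^{x}\frac{\binom{n-j-1}{k-1}}{j},& l=1,\\[6pt] \frac{k\cdot x!\,(n-l-x)!}{l(l-1)\,n!}\sum_{j=0}^{l-2}\binom{k-1}{j}\binom{n-k}{x+l-j-1},& 1<l\le k.\end{cases}$$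
   Context: Binomial convention: for integers $m,j$, $\binom{m}{j}=\frac{m(m-1)\cdots(m-j+1)}{j!}$ if $j\ge 0$ and $\binom{m}{j}=0$ if $j<0$. Setting (generalized secretary problem). There are $n$ candidates with distinct ranks $1,\ldots,n$ (rank $1$ is the best) arriving in uniformly random order: all $n!$ orderings are equally likely. An ordering is a permutation $\pi$ of $\{1,\ldots,n\}$, where $\pi(i)$ is the rank of the $i$-th candidate. At time $i$ only the relative ranks of the first $i$ candidates are known. Success means selecting a candidate of rank in $\{1,\ldots,k\}$. Policy associated with a sequence. Let $(s_1,\ldots,s_k)$ be a non-decreasing sequence of integers with $l\le s_l<n$ for every $1\le l\le k$, and put $s_{k+1}:=n-1$. The policy with this sequence selects the $i_0$-th candidate, where $i_0\in\{1,\ldots,n\}$ is the smallest integer for which there is $l\in\{1,\ldots,k\}$ with (i) $s_l<i_0\le s_{l+1}$, and (ii) the $i_0$-th candidate is one of the $l$ best among the first $i_0$ candidates. If no such $i_0$ exists, it selects the $n$-th candidate. -}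

module Defs where

open import Data.Bool.Base using (if_then_else_)
open import Data.Fin.Base as Fin using (Fin; zero; suc; toℕ; fromℕ; inject₁; punchIn)
open import Data.Fin.Permutation as Perm
  using (Permutation′; _⟨$⟩ʳ_; insert; remove; insert-punchIn; insert-remove)
import Data.Fin.Properties as Fin
open import Data.Integer.Base as ℤ using (ℤ; +_; -[1+_]; 1ℤ)
import Data.Integer.Properties as ℤ
open import Data.List.Base using (List; []; _∷_; allFin; cartesianProductWith; filter; find; length)
open import Data.List.Membership.Propositional.Properties using (∈-allFin)
import Data.List.Membership.Setoid as Membership
import Data.List.Membership.Setoid.Properties as Membership
open import Data.List.Relation.Unary.All using ([])
open import Data.List.Relation.Unary.AllPairs using ([]; _∷_)
open import Data.List.Relation.Unary.Any using (here)
import Data.List.Relation.Unary.Unique.Propositional.Properties as Unique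
open import Data.List.Relation.Unary.Unique.Setoid using (Unique)
import Data.List.Relation.Unary.Unique.Setoid.Properties as UniqueS
open import Data.Maybe.Base using (fromMaybe)
open import Data.Nat.Base as ℕ
  using (ℕ; zero; suc; 2+; _∸_; _≤_; _<_; _!; NonZero; z≤n; s≤s)
import Data.Nat.Properties as ℕ
open import Data.Product.Base using (∃; _×_; _,_)
open import Data.Rational.Base using (ℚ; 0ℚ; 1ℚ; _/_; _+_; _-_; -_; _*_; _÷_; +-0-rawMonoid)
import Data.Rational.Base as ℚ
import Data.Rational.Properties as ℚ
open import Data.Vec.Base using (Vec; lookup; _∷ʳ_)
open import Function.Base using (_∘_)
open import Relation.Binary.Bundles using (Setoid)
open import Relation.Binary.PropositionalEquality
  using (_≡_; refl; sym; trans; cong; cong₂; subst; setoid; module ≡-Reasoning)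
open import Relation.Nullary using (Dec; yes; no)
open import Relation.Nullary.Decidable using (_×-dec_)
open import Relation.Unary using (Decidable)
open import Level using (0ℓ)

open import Algebra.Definitions.RawMonoid +-0-rawMonoid public using ()
  renaming (sum to ∑)
open import Algebra.Definitions.RawMonoid ℕ.*-1-rawMonoid public using ()
  renaming (sum to ∏)

infix 7 _/!_

_/!_ : ℤ → ℕ → ℚ
i /! m = (i / m !) {{m ℕ.!≢0}}

infix 5 ∑[1⋯_]_

∑[1⋯_]_ : ℕ → ((j : ℕ) .{{_ : NonZero j}} → ℚ) → ℚ
∑[1⋯ x ] f = ∑ {x} λ i → f (suc (toℕ i))

ι : ℕ → ℚ
ι m = + m / 1

------------------------------------------------------------------------
-- Binomial coefficients with integer arguments

-- m (m − 1) ⋯ (m − j + 1)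
fall : ℤ → ℕ → ℤ
fall m zero    = 1ℤ
fall m (suc j) = fall m j ℤ.* (m ℤ.- + j)

binom : ℤ → ℤ → ℚ
binom m (+ j)    = fall m j /! j
binom m -[1+ _ ] = 0ℚ

private
  *-pos : ∀ i j → ℤ.Positive i → ℤ.Positive j → ℤ.Positive (i ℤ.* j)
  *-pos ℤ.+[1+ _ ] ℤ.+[1+ _ ] _ _ = _

  fall-pos : ∀ n k → k ≤ n → ℤ.Positive (fall (+ n) k)
  fall-pos n zero    _   = _
  fall-pos n (suc k) k<n =
    *-pos (fall (+ n) k) (+ n ℤ.- + k) (fall-pos n k (ℕ.<⇒≤ k<n))
      (ℤ.positive (subst (ℤ.0ℤ ℤ.<_)
        (trans (sym (ℤ.⊖-≥ (ℕ.<⇒≤ k<n))) (sym (ℤ.m-n≡m⊖n n k)))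
        (ℤ.+<+ (ℕ.m<n⇒0<n∸m k<n))))

  /-pos : ∀ i d .{{_ : NonZero d}} → ℤ.Positive i → ℚ.Positive (i / d)
  /-pos (ℤ.+[1+ m ]) d _ = ℚ.normalize-pos (suc m) d

binom-nonZero : ∀ {n k} → k ≤ n → ℚ.NonZero (binom (+ n) (+ k))
binom-nonZero {n} {k} k≤n =
  ℚ.pos⇒nonZero (binom (+ n) (+ k)) {{/-pos (fall (+ n) k) (k !) {{k ℕ.!≢0}} (fall-pos n k k≤n)}}

------------------------------------------------------------------------
-- Orderings of the candidates

-- π ⟨$⟩ʳ p is the rank of the candidate at position p.  Positions and
-- ranks are zero-based: p : Fin n is position suc (toℕ p), and likewise
-- for ranks, the best rank being zero.
orderings : ∀ n → List (Permutation′ n)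
orderings zero    = Perm.id ∷ []
orderings (suc n) = cartesianProductWith (insert (fromℕ n)) (allFin (suc n)) (orderings n)

≈-setoid : ℕ → Setoid 0ℓ 0ℓ
≈-setoid n = record
  { Carrier       = Permutation′ n
  ; _≈_           = Perm._≈_
  ; isEquivalence = record
    { refl  = λ _ → refl
    ; sym   = λ p i → sym (p i)
    ; trans = λ p q i → trans (p i) (q i)
    }
  }

private
  insert-at : ∀ {n} (i j : Fin (suc n)) (π : Permutation′ n) → insert i j π ⟨$⟩ʳ i ≡ j
  insert-at i j π with i Fin.≟ i
  ... | yes _  = refl
  ... | no i≢i with () ← i≢i refl

  insert-cong : ∀ {n} (i : Fin (suc n)) {j j′} {π ρ : Permutation′ n} →
                j ≡ j′ → π Perm.≈ ρ → insert i j π Perm.≈ insert i j′ ρ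
  insert-cong i {j} refl π≈ρ m with i Fin.≟ m
  ... | yes _ = refl
  ... | no  _ = cong (punchIn j) (π≈ρ _)

  insert-injective : ∀ {n} (i : Fin (suc n)) {j j′} {π ρ : Permutation′ n} →
                     insert i j π Perm.≈ insert i j′ ρ → j ≡ j′ × π Perm.≈ ρ
  insert-injective i {j} {j′} {π} {ρ} eq
    with refl ← trans (sym (insert-at i j π)) (trans (eq i) (insert-at i j′ ρ)) =
    refl , λ m → Fin.punchIn-injective j _ _
      (trans (sym (insert-punchIn i j π m)) (trans (eq (punchIn i m)) (insert-punchIn i j ρ m)))

orderings-complete : ∀ {n} (π : Permutation′ n) → Membership._∈_ (≈-setoid n) π (orderings n)
orderings-complete {zero}  π = here λ ()
orderings-complete {suc n} π =
  Membership.∈-resp-≈ (≈-setoid (suc n))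
    {x = insert (fromℕ n) (π ⟨$⟩ʳ fromℕ n) (remove (fromℕ n) π)} {π}
    (insert-remove (fromℕ n) π)
    (Membership.∈-cartesianProductWith⁺ (setoid (Fin (suc n))) (≈-setoid n) (≈-setoid (suc n))
      (λ {j} {j′} {π} {ρ} → insert-cong (fromℕ n) {π = π} {ρ})
      (∈-allFin (π ⟨$⟩ʳ fromℕ n)) (orderings-complete (remove (fromℕ n) π)))

orderings-unique : ∀ n → Unique (≈-setoid n) (orderings n)
orderings-unique zero    = [] ∷ []
orderings-unique (suc n) =
  UniqueS.cartesianProductWith⁺ (setoid (Fin (suc n))) (≈-setoid n) (≈-setoid (suc n))
    (insert (fromℕ n)) (λ {j} {j′} {π} {ρ} → insert-injective (fromℕ n) {π = π} {ρ})
    (Unique.allFin⁺ (suc n)) (orderings-unique n)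

probability : ∀ {n} {E : Permutation′ n → Set} → Decidable E → ℚ
probability {n} E? = + length (filter E? (orderings n)) /! n

------------------------------------------------------------------------
-- Policies

-- The rank of the candidate at position p among those seen up to p,
-- counted from one.
relativeRank : ∀ {n} → Permutation′ n → Fin n → ℕ
relativeRank {n} π p =
  length (filter (λ q → (q Fin.≤? p) ×-dec ((π ⟨$⟩ʳ q) Fin.≤? (π ⟨$⟩ʳ p))) (allFin n))

-- The index i : Fin k stands for l = suc (toℕ i), so that s_l = lookup s i
-- and s_{l+1} = lookup (s ∷ʳ (n ∸ 1)) (suc i).
Accepts : ∀ {n k} → Vec ℕ k → Permutation′ n → Fin n → Set
Accepts {n} {k} s π p = ∃ λ (i : Fin k) →
  (lookup s i < suc (toℕ p) × suc (toℕ p) ≤ lookup (s ∷ʳ (n ∸ 1)) (suc i)) ×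
  relativeRank π p ≤ suc (toℕ i)

accepts? : ∀ {n k} (s : Vec ℕ k) (π : Permutation′ n) → Decidable (Accepts s π)
accepts? {n} s π p = Fin.any? λ i →
  ((lookup s i ℕ.<? suc (toℕ p)) ×-dec (suc (toℕ p) ℕ.≤? lookup (s ∷ʳ (n ∸ 1)) (suc i))) ×-dec
  (relativeRank π p ℕ.≤? suc (toℕ i))

last : ∀ {n} .{{_ : NonZero n}} → Fin n
last {suc n} = fromℕ n

selected : ∀ {n k} .{{_ : NonZero n}} → Vec ℕ k → Permutation′ n → Fin n
selected {n} s π = fromMaybe last (find (accepts? s π) (allFin n))

Success : ∀ {n k} .{{_ : NonZero n}} → Vec ℕ k → Permutation′ n → Set
Success {k = k} s π = toℕ (π ⟨$⟩ʳ selected s π) < k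

success? : ∀ {n k} .{{_ : NonZero n}} (s : Vec ℕ k) → Decidable (Success {n} s)
success? {k = k} s π = toℕ (π ⟨$⟩ʳ selected s π) ℕ.<? k

module _ {n k : ℕ} (k<n : k < n) where

  private instance
    n-nonZero : NonZero n
    n-nonZero = ℕ.>-nonZero (ℕ.≤-<-trans z≤n k<n)

  infix 8 _/nCk

  _/nCk : ℚ → ℚ
  p /nCk = (p ÷ binom (+ n) (+ k)) {{binom-nonZero (ℕ.<⇒≤ k<n)}}

  successProbability : Vec ℕ k → ℚ
  successProbability s = probability (success? {n} s)

  -- t_l = s_l − l + 1 with l = suc (toℕ i); the truncation is harmless
  -- because l ≤ s_l.
  t : Vec ℕ k → Fin k → ℕ
  t s i = suc (lookup s i) ∸ suc (toℕ i)

  -- Meaningful for l ≤ k and 1 ≤ x ≤ n − l.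
  d : (l x : ℕ) → ℚ
  d 0 x = - 1ℚ + (+ (k ℕ.* x) / n)
    + binom (+ n ℤ.- + x ℤ.- 1ℤ) (+ k) /nCk
    + (ι x /nCk) * (∑[1⋯ x ] λ j → binom (+ n ℤ.- + j ℤ.- 1ℤ) (+ k ℤ.- 1ℤ) * (+ 1 / j))
  d 1 x = - (+ k / n)
    - (1ℚ /nCk) * (∑[1⋯ x ] λ j → binom (+ n ℤ.- + j ℤ.- 1ℤ) (+ k ℤ.- 1ℤ) * (+ 1 / j))
  d l@(2+ m) x =
    (+ (k ℕ.* x ! ℕ.* (n ∸ l ∸ x) !) / (l ℕ.* suc m ℕ.* n !))
      * ∑ {suc m} (λ j →
          binom (+ k ℤ.- 1ℤ) (+ toℕ j)
          * binom (+ n ℤ.- + k) (+ x ℤ.+ + l ℤ.- + toℕ j ℤ.- 1ℤ))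
    where instance
      _ = ℕ.m*n≢0 (l ℕ.* suc m) (n !) {{_}} {{n ℕ.!≢0}}

  -- Meaningful for k ≥ 1.
  δ : ℚ
  δ = if k ℕ.≡ᵇ 1
    then - ((+ 1 / n) * (∑[1⋯ n ∸ 1 ] λ j → + 1 / j))
    else + ((n ∸ k) !) /! n

module Submission where

open import Defs
open import Algebra.Bundles using (CommutativeRing)
open import Data.Bool.Base using (true; false; if_then_else_)
open import Data.Fin.Base as Fin using (Fin; zero; suc; toℕ; fromℕ; inject; inject₁; punchIn)
open import Data.Fin.Permutation using (Permutation′; _⟨$⟩ʳ_; insert; insert-punchIn)
import Data.Fin.Properties as Fin
open import Data.Fin.Relation.Unary.Top using (view; ‵fromℕ; ‵inject₁)
open import Data.Integer.Base as ℤ using (ℤ; +_; -[1+_]; 1ℤ)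
import Data.Integer.Properties as ℤ
import Data.Integer.Tactic.RingSolver as ℤ-ring
open import Data.List.Base
  using (List; []; _∷_; [_]; _++_; map; allFin; tabulate; cartesianProductWith; filter; find; length)
import Data.List.Properties as List
open import Data.Maybe.Base as Maybe using (Maybe; just; nothing; fromMaybe; _<∣>_)
import Data.Maybe.Properties as Maybe
open import Data.Nat.Base as ℕ
  using (ℕ; zero; suc; 2+; NonZero; _∸_; _≤_; _<_; _<ᵇ_; _⊓_; z≤n; s≤s; s≤s⁻¹; _!)
open import Data.Nat.ListAction using (sum)
open import Data.Nat.ListAction.Properties using (sum-++)
import Data.Nat.Properties as ℕ
import Data.Nat.Tactic.RingSolver as ℕ-ring
open import Data.Product.Base using (∃; _×_; _,_; proj₁; proj₂)
open import Data.Rational.Base using (ℚ; 0ℚ; 1ℚ; _/_; _+_; _-_; -_; _*_; 1/_; toℚᵘ)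
import Data.Rational.Properties as ℚ
open import Data.Rational.Unnormalised.Base as ℚᵘ using (mkℚᵘ; *≡*)
import Data.Rational.Unnormalised.Properties as ℚᵘ
open import Data.Sum.Base using (_⊎_; inj₁; inj₂)
open import Data.Vec.Base using (Vec; []; _∷_; lookup; _∷ʳ_)
open import Function.Base using (_∘_; id)
open import Function.Bundles using (mk⇔)
open import Level using (0ℓ)
import Relation.Binary.Definitions as B
open import Relation.Binary.PropositionalEquality
  using (_≡_; refl; sym; trans; cong; cong₂; subst; subst₂; module ≡-Reasoning)
import Relation.Binary.Reasoning.Setoid as SetoidReasoning
open import Relation.Nullary using (Dec; yes; no; does; ¬_; contradiction)
open import Relation.Nullary.Decidable using (_×-dec_; dec-true; dec-false; does-⇔)
open import Relation.Unary using (Decidable)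
open import Tactic.RingSolver using (solve-∀)
open import Tactic.RingSolver.Core.AlmostCommutativeRing using (AlmostCommutativeRing; fromCommutativeRing)

open import Algebra.Properties.CommutativeMonoid.Sum ℕ.+-0-commutativeMonoid
  using (sum-init-last; sum-permute; sum-cong-≗) renaming (sum to ∑ᴺ)
open import Algebra.Properties.CommutativeMonoid.Sum ℚ.+-0-commutativeMonoid
  using () renaming (sum-init-last to ∑-init-last; sum-cong-≗ to ∑-cong)
open import Algebra.Properties.Semiring.Sum (CommutativeRing.semiring ℚ.+-*-commutativeRing)
  using () renaming (*-distribˡ-sum to *-distribˡ-∑)

open ≡-Reasoning

-- Let σ_l(i) be the number of ways to complete an ordering of i candidates so
-- that a given one of them ends among the k best, summed over the l best
-- current ranks, and u(i) the number of ways to complete an ordering of i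
-- candidates, none of them selected, to a success.  The relative ranks of
-- successive candidates are independent, so u(i) = σ_l(i+1) + (i+1−l) u(i+1)
-- for s_l ≤ i < s_{l+1}, and σ_l(i) = (i−l) σ_l(i+1) + l σ_{l+1}(i+1) always.
-- Hence (i−l)!/n! (u(i) − σ_{l−1}(i)/(l−1)) is constant for s_l ≤ i ≤ s_{l+1}
-- (for l = 0 the correction term is absent, for l = 1 it involves the sum in
-- d_1), and at i = s_{l+1} the value for l is t_{l+1} times the value for l+1
-- minus d_l(t_{l+1}).  Unrolling from i = 0 to i = n−1 gives the formula.  The
-- closed form of d_l holds because (m+1) σ_m − m σ_{m+1} is a multiple of a
-- truncated Vandermonde sum.

-- Orderings as sequences of relative ranks

-- The correction in the potential is a particular solution. Divided by l-1, the recurrence of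
-- σ_{l-1} reads σ_{l-1}(i)/(l-1) = (i+1-l) σ_{l-1}(i+1)/(l-1) + σ_l(i+1), which is the recurrence
-- of u on the stretch from s_l to s_{l+1}. The difference w therefore satisfies w(i) = (i+1-l)
-- w(i+1), and the factor (i-l)! turns it into a constant. At l = 1 the division fails, since σ_0 =
-- 0 gives no particular solution. There the inhomogeneous part has to be summed term by term, and
-- this is the origin of the sums over 1/j in d_0, d_1 and δ_{1,n}. The d_l are then forced: each is
-- the price of exchanging one correction for the next at a threshold. The induction runs backwards
-- from complete orderings, so that only the number of candidates seen and the current rank of the
-- selected one, if any, have to be remembered.

⟦_⟧ : {P : Set} → Dec P → ℕ
⟦ P? ⟧ = if does P? then 1 else 0

length-filter : ∀ {A : Set} {P : A → Set} (P? : Decidable P) xs →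
                length (filter P? xs) ≡ sum (map (λ x → ⟦ P? x ⟧) xs)
length-filter P? []       = refl
length-filter P? (x ∷ xs) with does (P? x)
... | true  = cong suc (length-filter P? xs)
... | false = length-filter P? xs

Σ< : ℕ → (ℕ → ℕ) → ℕ
Σ< zero    f = 0
Σ< (suc n) f = Σ< n f ℕ.+ f n

Σ<-cong : ∀ n {f g : ℕ → ℕ} → (∀ i → i < n → f i ≡ g i) → Σ< n f ≡ Σ< n g
Σ<-cong zero    eq = refl
Σ<-cong (suc n) eq = cong₂ ℕ._+_ (Σ<-cong n λ i i<n → eq i (ℕ.m<n⇒m<1+n i<n)) (eq n (ℕ.n<1+n n))

∑ᴺ-toℕ : ∀ n (f : ℕ → ℕ) → ∑ᴺ {n} (f ∘ toℕ) ≡ Σ< n f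
∑ᴺ-toℕ zero    f = refl
∑ᴺ-toℕ (suc n) f = begin
  ∑ᴺ {suc n} (f ∘ toℕ)                                  ≡⟨ sum-init-last (f ∘ toℕ) ⟩
  ∑ᴺ {n} (f ∘ toℕ ∘ inject₁) ℕ.+ f (toℕ (fromℕ n))
    ≡⟨ cong₂ ℕ._+_ (sum-cong-≗ {n} (cong f ∘ Fin.toℕ-inject₁)) (cong f (Fin.toℕ-fromℕ n)) ⟩
  ∑ᴺ {n} (f ∘ toℕ) ℕ.+ f n                                ≡⟨ cong (ℕ._+ f n) (∑ᴺ-toℕ n f) ⟩
  Σ< n f ℕ.+ f n                                          ∎

-- Every sum over the rank of a newcomer has this shape: below a bound the ranks are told apart, and
-- from the bound on they all lead to the same outcome.
Σ<-split : ∀ p q {b} {f h : ℕ → ℕ} → (∀ i → i < p → h i ≡ f i) → (∀ i → p ≤ i → h i ≡ b) →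
           Σ< (p ℕ.+ q) h ≡ Σ< p f ℕ.+ q ℕ.* b
Σ<-split p zero    {b} {f} {h} eq eq′ = begin
  Σ< (p ℕ.+ 0) h  ≡⟨ cong (λ x → Σ< x h) (ℕ.+-identityʳ p) ⟩
  Σ< p h        ≡⟨ Σ<-cong p eq ⟩
  Σ< p f        ≡⟨ ℕ.+-identityʳ _ ⟨
  Σ< p f ℕ.+ 0    ∎
Σ<-split p (suc q) {b} {f} {h} eq eq′ = begin
  Σ< (p ℕ.+ suc q) h           ≡⟨ cong (λ x → Σ< x h) (ℕ.+-suc p q) ⟩
  Σ< (p ℕ.+ q) h ℕ.+ h (p ℕ.+ q)   ≡⟨ cong₂ ℕ._+_ (Σ<-split p q eq eq′) (eq′ (p ℕ.+ q) (ℕ.m≤m+n p q)) ⟩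
  Σ< p f ℕ.+ q ℕ.* b ℕ.+ b         ≡⟨ (λ s q b → solve-+ s (q ℕ.* b) b) (Σ< p f) q b ⟩
  Σ< p f ℕ.+ (b ℕ.+ q ℕ.* b)       ∎
  where
  solve-+ : ∀ x y z → x ℕ.+ y ℕ.+ z ≡ x ℕ.+ (z ℕ.+ y)
  solve-+ = ℕ-ring.solve-∀

Σ<-const : ∀ n b → Σ< n (λ _ → b) ≡ n ℕ.* b
Σ<-const n b = Σ<-split 0 n {f = λ _ → 0} {h = λ _ → b} (λ _ ()) (λ _ _ → refl)

sum-map-tabulate : ∀ {A : Set} n (g : A → ℕ) (f : Fin n → A) → sum (map g (tabulate f)) ≡ ∑ᴺ {n} (g ∘ f)
sum-map-tabulate zero    g f = refl
sum-map-tabulate (suc n) g f = cong (g (f zero) ℕ.+_) (sum-map-tabulate n g (f ∘ suc))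

sum-map-+ : ∀ {A : Set} (f g : A → ℕ) xs → sum (map (λ x → f x ℕ.+ g x) xs) ≡ sum (map f xs) ℕ.+ sum (map g xs)
sum-map-+ f g []       = refl
sum-map-+ f g (x ∷ xs) rewrite sum-map-+ f g xs = interchange (f x) (g x) (sum (map f xs)) (sum (map g xs))
  where
  interchange : ∀ a b c d → a ℕ.+ b ℕ.+ (c ℕ.+ d) ≡ a ℕ.+ c ℕ.+ (b ℕ.+ d)
  interchange = ℕ-ring.solve-∀

sum-map-0 : ∀ {A : Set} (xs : List A) → sum (map (λ _ → 0) xs) ≡ 0
sum-map-0 []       = refl
sum-map-0 (x ∷ xs) = sum-map-0 xs

-- The summation order is exchanged: the ordering of the earlier candidates stays fixed outside
-- while the rank of the newcomer varies inside.
sum-map-cartesianProductWith : ∀ {A B C : Set} (f : A → B → C) (h : C → ℕ) xs ys →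
  sum (map h (cartesianProductWith f xs ys)) ≡ sum (map (λ y → sum (map (λ x → h (f x y)) xs)) ys)
sum-map-cartesianProductWith f h []       ys = sym (sum-map-0 ys)
sum-map-cartesianProductWith f h (x ∷ xs) ys = begin
  sum (map h (map (f x) ys ++ zs))               ≡⟨ cong sum (List.map-++ h (map (f x) ys) zs) ⟩
  sum (map h (map (f x) ys) ++ map h zs)         ≡⟨ sum-++ (map h (map (f x) ys)) (map h zs) ⟩
  sum (map h (map (f x) ys)) ℕ.+ sum (map h zs)
    ≡⟨ cong₂ ℕ._+_ (cong sum (sym (List.map-∘ ys))) (sum-map-cartesianProductWith f h xs ys) ⟩
  sum (map (h ∘ f x) ys) ℕ.+ sum (map (λ y → sum (map (λ x → h (f x y)) xs)) ys)
                                                 ≡⟨ sum-map-+ (h ∘ f x) _ ys ⟨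
  sum (map (λ y → h (f x y) ℕ.+ sum (map (λ x → h (f x y)) xs)) ys) ∎
  where zs = cartesianProductWith f xs ys

find-tabulate-∷ʳ : ∀ {A : Set} {P : A → Set} (P? : Decidable P) n (f : Fin (suc n) → A) →
  find P? (tabulate f) ≡ (find P? (tabulate (f ∘ inject₁)) <∣> find P? [ f (fromℕ n) ])
find-tabulate-∷ʳ P? zero    f = refl
find-tabulate-∷ʳ P? (suc n) f with does (P? (f zero))
... | true  = refl
... | false = find-tabulate-∷ʳ P? n (f ∘ suc)

map-find-cong : ∀ {A B C : Set} {P : A → Set} {Q : B → Set} (P? : Decidable P) (Q? : Decidable Q)
  {g : A → C} {g′ : B → C} n {f : Fin n → A} {f′ : Fin n → B} →
  (∀ i → does (P? (f i)) ≡ does (Q? (f′ i))) → (∀ i → g (f i) ≡ g′ (f′ i)) →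
  Maybe.map g (find P? (tabulate f)) ≡ Maybe.map g′ (find Q? (tabulate f′))
map-find-cong P? Q? zero    eq eq′ = refl
map-find-cong P? Q? (suc n) {f} {f′} eq eq′ with does (P? (f zero)) | does (Q? (f′ zero)) | eq zero
... | true  | .true  | refl = cong just (eq′ zero)
... | false | .false | refl = map-find-cong P? Q? n (eq ∘ suc) (eq′ ∘ suc)

-- Ranks after the arrival of one more candidate

bump : ℕ → ℕ → ℕ
bump j c = if j <ᵇ suc c then suc c else c

toℕ-punchIn : ∀ {n} (j : Fin (suc n)) (c : Fin n) → toℕ (punchIn j c) ≡ bump (toℕ j) (toℕ c)
toℕ-punchIn zero    c       = refl
toℕ-punchIn (suc j) zero    = refl
toℕ-punchIn (suc j) (suc c) rewrite toℕ-punchIn j c with toℕ j <ᵇ suc (toℕ c)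
... | true  = refl
... | false = refl

punchIn-fromℕ : ∀ {n} (p : Fin n) → punchIn (fromℕ n) p ≡ inject₁ p
punchIn-fromℕ zero    = refl
punchIn-fromℕ (suc p) = cong suc (punchIn-fromℕ p)

insert-at : ∀ {n} (i j : Fin (suc n)) (π : Permutation′ n) → insert i j π ⟨$⟩ʳ i ≡ j
insert-at i j π with i Fin.≟ i
... | yes _  = refl
... | no i≢i with () ← i≢i refl

insert-inject₁ : ∀ {n} (j : Fin (suc n)) (π : Permutation′ n) p →
                 insert (fromℕ n) j π ⟨$⟩ʳ inject₁ p ≡ punchIn j (π ⟨$⟩ʳ p)
insert-inject₁ {n} j π p =
  trans (cong (insert (fromℕ n) j π ⟨$⟩ʳ_) (sym (punchIn-fromℕ p))) (insert-punchIn (fromℕ n) j π p)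

⟦⟧-cong : {P Q : Set} {P? : Dec P} {Q? : Dec Q} → (P → Q) → (Q → P) → ⟦ P? ⟧ ≡ ⟦ Q? ⟧
⟦⟧-cong {P? = P?} {Q?} f g = cong (if_then 1 else 0) (does-⇔ (mk⇔ f g) P? Q?)

relativeRank≡∑ : ∀ {n} (π : Permutation′ n) p →
  relativeRank π p ≡ ∑ᴺ λ q → ⟦ (q Fin.≤? p) ×-dec ((π ⟨$⟩ʳ q) Fin.≤? (π ⟨$⟩ʳ p)) ⟧
relativeRank≡∑ {n} π p = trans (length-filter _ (allFin n)) (sum-map-tabulate n _ id)

-- `punchIn` preserves the order of the old ranks, and the newcomer stands at a later position and
-- is not counted.
relativeRank-insert-inject₁ : ∀ {n} (j : Fin (suc n)) (π : Permutation′ n) p →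
  relativeRank (insert (fromℕ n) j π) (inject₁ p) ≡ relativeRank π p
relativeRank-insert-inject₁ {n} j π p = begin
  relativeRank ρ (inject₁ p)                      ≡⟨ relativeRank≡∑ ρ (inject₁ p) ⟩
  ∑ᴺ (λ q → ⟦ R? q ⟧)                             ≡⟨ sum-init-last (λ q → ⟦ R? q ⟧) ⟩
  ∑ᴺ (λ q → ⟦ R? (inject₁ q) ⟧) ℕ.+ ⟦ R? (fromℕ n) ⟧ ≡⟨ cong₂ ℕ._+_ (sum-cong-≗ earlier) later ⟩
  ∑ᴺ (λ q → ⟦ R′? q ⟧) ℕ.+ 0                        ≡⟨ ℕ.+-identityʳ _ ⟩
  ∑ᴺ (λ q → ⟦ R′? q ⟧)                            ≡⟨ relativeRank≡∑ π p ⟨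
  relativeRank π p                                ∎
  where
  ρ = insert (fromℕ n) j π
  R? = λ q → (q Fin.≤? inject₁ p) ×-dec ((ρ ⟨$⟩ʳ q) Fin.≤? (ρ ⟨$⟩ʳ inject₁ p))
  R′? = λ q → (q Fin.≤? p) ×-dec ((π ⟨$⟩ʳ q) Fin.≤? (π ⟨$⟩ʳ p))
  earlier : ∀ q → ⟦ R? (inject₁ q) ⟧ ≡ ⟦ R′? q ⟧
  earlier q = ⟦⟧-cong {P? = R? (inject₁ q)} {Q? = R′? q}
    (λ (q≤p , le) →
      subst₂ _≤_ (Fin.toℕ-inject₁ q) (Fin.toℕ-inject₁ p) q≤p ,
      Fin.punchIn-cancel-≤ j _ _ (subst₂ Fin._≤_ (insert-inject₁ j π q) (insert-inject₁ j π p) le))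
    (λ (q≤p , le) →
      subst₂ _≤_ (sym (Fin.toℕ-inject₁ q)) (sym (Fin.toℕ-inject₁ p)) q≤p ,
      subst₂ Fin._≤_ (sym (insert-inject₁ j π q)) (sym (insert-inject₁ j π p)) (Fin.punchIn-mono-≤ j _ _ le))
  later : ⟦ R? (fromℕ n) ⟧ ≡ 0
  later = cong (if_then 1 else 0) (dec-false (R? (fromℕ n)) λ (n≤p , _) →
    ℕ.<⇒≱ (Fin.inject₁ℕ< p) (subst (_≤ toℕ (inject₁ p)) (Fin.toℕ-fromℕ n) n≤p))

-- At the last position the test on positions always succeeds. The permutation then reindexes the
-- count by rank, which leaves the numbers 0, ..., j.
relativeRank-insert-last : ∀ {n} (j : Fin (suc n)) (π : Permutation′ n) →
  relativeRank (insert (fromℕ n) j π) (fromℕ n) ≡ suc (toℕ j)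
relativeRank-insert-last {n} j π = begin
  relativeRank ρ (fromℕ n)               ≡⟨ relativeRank≡∑ ρ (fromℕ n) ⟩
  ∑ᴺ (λ q → ⟦ R? q ⟧)                    ≡⟨ sum-cong-≗ {suc n} (λ q → ⟦⟧-cong {P? = R? q} {Q? = toℕ (ρ ⟨$⟩ʳ q) ℕ.≤? toℕ j}
                                              (λ (_ , le) → subst (λ x → toℕ (ρ ⟨$⟩ʳ q) ≤ toℕ x) (insert-at (fromℕ n) j π) le)
                                              (λ le → Fin.≤fromℕ q , subst (λ x → toℕ (ρ ⟨$⟩ʳ q) ≤ toℕ x) (sym (insert-at (fromℕ n) j π)) le)) ⟩
  ∑ᴺ {suc n} (λ q → ⟦ toℕ (ρ ⟨$⟩ʳ q) ℕ.≤? toℕ j ⟧)  ≡⟨ sum-permute {suc n} (λ q → ⟦ toℕ q ℕ.≤? toℕ j ⟧) ρ ⟨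
  ∑ᴺ {suc n} (λ q → ⟦ toℕ q ℕ.≤? toℕ j ⟧)  ≡⟨ ∑ᴺ-toℕ (suc n) (λ q → ⟦ q ℕ.≤? toℕ j ⟧) ⟩
  Σ< (suc n) (λ q → ⟦ q ℕ.≤? toℕ j ⟧)      ≡⟨ cong (λ x → Σ< x (λ q → ⟦ q ℕ.≤? toℕ j ⟧)) (ℕ.m+[n∸m]≡n (Fin.toℕ<n j)) ⟨
  Σ< (suc (toℕ j) ℕ.+ (suc n ∸ suc (toℕ j))) (λ q → ⟦ q ℕ.≤? toℕ j ⟧)
                                         ≡⟨ Σ<-split (suc (toℕ j)) (suc n ∸ suc (toℕ j)) {b = 0} {f = λ _ → 1}
                                              (λ i i≤j → cong (if_then 1 else 0) (dec-true (i ℕ.≤? toℕ j) (s≤s⁻¹ i≤j)))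
                                              (λ i i>j → cong (if_then 1 else 0) (dec-false (i ℕ.≤? toℕ j) (ℕ.<⇒≱ i>j))) ⟩
  Σ< (suc (toℕ j)) (λ _ → 1) ℕ.+ (suc n ∸ suc (toℕ j)) ℕ.* 0
                                         ≡⟨ cong₂ ℕ._+_ (Σ<-const (suc (toℕ j)) 1) (ℕ.*-zeroʳ (suc n ∸ suc (toℕ j))) ⟩
  suc (toℕ j) ℕ.* 1 ℕ.+ 0                    ≡⟨ trans (ℕ.+-identityʳ _) (ℕ.*-identityʳ _) ⟩
  suc (toℕ j)                            ∎
  where
  ρ = insert (fromℕ n) j π
  R? = λ q → (q Fin.≤? fromℕ n) ×-dec ((ρ ⟨$⟩ʳ q) Fin.≤? (ρ ⟨$⟩ʳ fromℕ n))

-- The selection as a process on the current rank of the selected candidate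

module Play {A : ℕ → ℕ → Set} (A? : B.Decidable A) where

  stop? : ∀ {n} (π : Permutation′ n) → Decidable (λ p → A (toℕ p) (relativeRank π p))
  stop? π p = A? (toℕ p) (relativeRank π p)

  -- The current rank, among the candidates seen so far, of the selected one.
  state : ∀ {n} → Permutation′ n → Maybe ℕ
  state {n} π = Maybe.map (λ p → toℕ (π ⟨$⟩ʳ p)) (find (stop? π) (allFin n))

  advance : ℕ → ℕ → Maybe ℕ → Maybe ℕ
  advance i j (just c) = just (bump j c)
  advance i j nothing  = if does (A? i (suc j)) then just j else nothing

  state-prefix : ∀ {n} (j : Fin (suc n)) (π : Permutation′ n) → let ρ = insert (fromℕ n) j π in
    Maybe.map (λ p → toℕ (ρ ⟨$⟩ʳ p)) (find (stop? ρ) (tabulate inject₁)) ≡ Maybe.map (bump (toℕ j)) (state π)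
  state-prefix {n} j π = trans
    (map-find-cong (stop? ρ) (stop? π) n
      (λ p → cong₂ (λ i r → does (A? i r)) (Fin.toℕ-inject₁ p) (relativeRank-insert-inject₁ j π p))
      (λ p → trans (cong toℕ (insert-inject₁ j π p)) (toℕ-punchIn j (π ⟨$⟩ʳ p))))
    (Maybe.map-∘ (find (stop? π) (allFin n)))
    where ρ = insert (fromℕ n) j π

  state-insert : ∀ {n} (j : Fin (suc n)) (π : Permutation′ n) →
                 state (insert (fromℕ n) j π) ≡ advance n (toℕ j) (state π)
  state-insert {n} j π = begin
    Maybe.map rank (find (stop? ρ) (allFin (suc n)))
      ≡⟨ cong (Maybe.map rank) (find-tabulate-∷ʳ (stop? ρ) n id) ⟩
    Maybe.map rank (find (stop? ρ) (tabulate inject₁) <∣> find (stop? ρ) [ fromℕ n ])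
      ≡⟨ map-<∣> (find (stop? ρ) (tabulate inject₁)) ⟩
    (Maybe.map rank (find (stop? ρ) (tabulate inject₁)) <∣> Maybe.map rank (find (stop? ρ) [ fromℕ n ]))
      ≡⟨ cong₂ _<∣>_ (state-prefix j π) last-step ⟩
    (Maybe.map (bump (toℕ j)) (state π) <∣> (if does (A? n (suc (toℕ j))) then just (toℕ j) else nothing))
      ≡⟨ combine (state π) ⟩
    advance n (toℕ j) (state π) ∎
    where
    ρ = insert (fromℕ n) j π
    rank = λ p → toℕ (ρ ⟨$⟩ʳ p)
    map-if : ∀ {b b′ x y} → b ≡ b′ → rank x ≡ y →
             Maybe.map rank (if b then just x else nothing) ≡ (if b′ then just y else nothing)
    map-if {true}  refl refl = refl
    map-if {false} refl refl = refl
    map-<∣> : ∀ {y} x → Maybe.map rank (x <∣> y) ≡ (Maybe.map rank x <∣> Maybe.map rank y)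
    map-<∣> (just _) = refl
    map-<∣> nothing  = refl
    last-step : Maybe.map rank (find (stop? ρ) [ fromℕ n ]) ≡
                (if does (A? n (suc (toℕ j))) then just (toℕ j) else nothing)
    last-step = map-if
      (cong₂ (λ i r → does (A? i r)) (Fin.toℕ-fromℕ n) (relativeRank-insert-last j π))
      (cong toℕ (insert-at (fromℕ n) j π))
    combine : ∀ st → (Maybe.map (bump (toℕ j)) st <∣> (if does (A? n (suc (toℕ j))) then just (toℕ j) else nothing))
                     ≡ advance n (toℕ j) st
    combine (just _) = refl
    combine nothing  = refl

  -- The default of `fromMaybe` is the last candidate itself, so the rule has no influence at the
  -- last position: accepted or not, that candidate is taken if none was before.
  rank-selected : ∀ {n} (j : Fin (suc n)) (π : Permutation′ n) → let ρ = insert (fromℕ n) j π in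
    toℕ (ρ ⟨$⟩ʳ fromMaybe (fromℕ n) (find (stop? ρ) (allFin (suc n)))) ≡
    fromMaybe (toℕ j) (Maybe.map (bump (toℕ j)) (state π))
  rank-selected {n} j π = begin
    rank (fromMaybe (fromℕ n) (find (stop? ρ) (allFin (suc n))))
      ≡⟨ cong (rank ∘ fromMaybe (fromℕ n)) (find-tabulate-∷ʳ (stop? ρ) n id) ⟩
    rank (fromMaybe (fromℕ n) (find (stop? ρ) (tabulate inject₁) <∣> find (stop? ρ) [ fromℕ n ]))
      ≡⟨ ignore-last (find (stop? ρ) (tabulate inject₁)) ⟩
    fromMaybe (rank (fromℕ n)) (Maybe.map rank (find (stop? ρ) (tabulate inject₁)))
      ≡⟨ cong₂ fromMaybe (cong toℕ (insert-at (fromℕ n) j π)) (state-prefix j π) ⟩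
    fromMaybe (toℕ j) (Maybe.map (bump (toℕ j)) (state π)) ∎
    where
    ρ = insert (fromℕ n) j π
    rank = λ p → toℕ (ρ ⟨$⟩ʳ p)
    ignore-last : ∀ x → rank (fromMaybe (fromℕ n) (x <∣> find (stop? ρ) [ fromℕ n ])) ≡
                        fromMaybe (rank (fromℕ n)) (Maybe.map rank x)
    ignore-last (just _) = refl
    ignore-last nothing with does (stop? ρ (fromℕ n))
    ... | true  = refl
    ... | false = refl

  total : ∀ n → (Maybe ℕ → ℕ) → ℕ
  total n f = sum (map (f ∘ state) (orderings n))

  -- Independence of the relative ranks in counting form: over each ordering of n candidates the
  -- newcomer takes each of the n + 1 ranks once.
  sum-orderings-suc : ∀ n (h : Permutation′ (suc n) → ℕ) (h′ : Maybe ℕ → ℕ → ℕ) →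
    (∀ j π → h (insert (fromℕ n) j π) ≡ h′ (state π) (toℕ j)) →
    sum (map h (orderings (suc n))) ≡ total n (λ st → Σ< (suc n) (h′ st))
  sum-orderings-suc n h h′ eq = trans
    (sum-map-cartesianProductWith (insert (fromℕ n)) h (allFin (suc n)) (orderings n))
    (cong sum (List.map-cong (λ π → begin
      sum (map (λ j → h (insert (fromℕ n) j π)) (allFin (suc n)))
        ≡⟨ sum-map-tabulate (suc n) _ id ⟩
      ∑ᴺ (λ j → h (insert (fromℕ n) j π))
        ≡⟨ sum-cong-≗ (λ j → eq j π) ⟩
      ∑ᴺ {suc n} (λ j → h′ (state π) (toℕ j))
        ≡⟨ ∑ᴺ-toℕ (suc n) (h′ (state π)) ⟩
      Σ< (suc n) (h′ (state π)) ∎) (orderings n)))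

  module _ (k : ℕ) where

    -- The number of ways to continue an ordering of i candidates to one of
    -- suc (r + i) candidates in which the selected one is among the k best.
    successes : (r i : ℕ) → Maybe ℕ → ℕ
    successes zero    i st = Σ< (suc i) λ j → ⟦ fromMaybe j (Maybe.map (bump j) st) ℕ.<? k ⟧
    successes (suc r) i st = Σ< (suc i) λ j → successes r (suc i) (advance i j st)

    -- Each step turns one placed candidate into one still to come. At i = 0 only the empty ordering
    -- remains, and the total is a single value of `successes`.
    total-successes : ∀ r i → total (r ℕ.+ i) (successes 0 (r ℕ.+ i)) ≡ total i (successes r i)
    total-successes zero    i = refl
    total-successes (suc r) i = begin
      total (suc (r ℕ.+ i)) (successes 0 (suc (r ℕ.+ i)))  ≡⟨ cong (λ x → total x (successes 0 x)) (ℕ.+-suc r i) ⟨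
      total (r ℕ.+ suc i) (successes 0 (r ℕ.+ suc i))      ≡⟨ total-successes r (suc i) ⟩
      total (suc i) (successes r (suc i))              ≡⟨ sum-orderings-suc i (successes r (suc i) ∘ state)
                                                            (λ st j → successes r (suc i) (advance i j st))
                                                            (λ j π → cong (successes r (suc i)) (state-insert j π)) ⟩
      total i (successes (suc r) i)                    ∎

    count-successes : ∀ m →
      length (filter (λ π → toℕ (π ⟨$⟩ʳ fromMaybe (fromℕ m) (find (stop? π) (allFin (suc m)))) ℕ.<? k) (orderings (suc m)))
        ≡ successes m 0 nothing
    count-successes m = begin
      length (filter S? (orderings (suc m)))         ≡⟨ length-filter S? (orderings (suc m)) ⟩
      sum (map (λ π → ⟦ S? π ⟧) (orderings (suc m))) ≡⟨ sum-orderings-suc m (λ π → ⟦ S? π ⟧)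
                                                          (λ st j → ⟦ fromMaybe j (Maybe.map (bump j) st) ℕ.<? k ⟧)
                                                          (λ j π → cong (λ x → ⟦ x ℕ.<? k ⟧) (rank-selected j π)) ⟩
      total m (successes 0 m)                        ≡⟨ cong (λ x → total x (successes 0 x)) (ℕ.+-identityʳ m) ⟨
      total (m ℕ.+ 0) (successes 0 (m ℕ.+ 0))            ≡⟨ total-successes m 0 ⟩
      successes m 0 nothing ℕ.+ 0                      ≡⟨ ℕ.+-identityʳ _ ⟩
      successes m 0 nothing                          ∎
      where S? = λ π → toℕ (π ⟨$⟩ʳ fromMaybe (fromℕ m) (find (stop? π) (allFin (suc m)))) ℕ.<? k

bump-≤ : ∀ {j c} → j ≤ c → bump j c ≡ suc c
bump-≤ {c = c} j≤c = cong (if_then suc c else c) (dec-true (_ ℕ.<? _) (s≤s j≤c))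

bump-> : ∀ {j c} → c < j → bump j c ≡ c
bump-> {c = c} c<j = cong (if_then suc c else c) (dec-false (_ ℕ.<? _) (ℕ.<⇒≱ (s≤s c<j)))

-- Counting the futures that keep a candidate among the k best

module Ranks (k : ℕ) where

  -- The number of ways to continue an ordering of i candidates to one of
  -- r + i candidates in which the candidate of current rank c is among the
  -- k best.
  completions : (r i c : ℕ) → ℕ
  completions zero    i c = ⟦ c ℕ.<? k ⟧
  completions (suc r) i c = Σ< (suc i) λ j → completions r (suc i) (bump j c)

  topCompletions : (r i l : ℕ) → ℕ
  topCompletions r i l = Σ< l (completions r i)

  -- Of the i + 1 possible newcomers, c + 1 push the candidate down by one rank and i - c leave it
  -- in place. The summand with factor c on the left stands for the subtraction in i - c.
  completions-suc : ∀ r {i c} → c ≤ i →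
    completions (suc r) i c ℕ.+ c ℕ.* completions r (suc i) c ≡
    suc c ℕ.* completions r (suc i) (suc c) ℕ.+ i ℕ.* completions r (suc i) c
  completions-suc r {i} {c} c≤i = begin
    Σ< (suc i) (λ j → h (bump j c)) ℕ.+ c ℕ.* h c
      ≡⟨ cong (λ x → Σ< x (λ j → h (bump j c)) ℕ.+ c ℕ.* h c) (ℕ.m+[n∸m]≡n (s≤s c≤i)) ⟨
    Σ< (suc c ℕ.+ (i ∸ c)) (λ j → h (bump j c)) ℕ.+ c ℕ.* h c
      ≡⟨ cong (ℕ._+ c ℕ.* h c) (Σ<-split (suc c) (i ∸ c) {f = λ _ → h (suc c)}
           (λ j j≤c → cong h (bump-≤ (s≤s⁻¹ j≤c))) (λ j c<j → cong h (bump-> c<j))) ⟩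
    Σ< (suc c) (λ _ → h (suc c)) ℕ.+ (i ∸ c) ℕ.* h c ℕ.+ c ℕ.* h c
      ≡⟨ cong (λ x → x ℕ.+ (i ∸ c) ℕ.* h c ℕ.+ c ℕ.* h c) (Σ<-const (suc c) (h (suc c))) ⟩
    suc c ℕ.* h (suc c) ℕ.+ (i ∸ c) ℕ.* h c ℕ.+ c ℕ.* h c
      ≡⟨ ℕ.+-assoc (suc c ℕ.* h (suc c)) ((i ∸ c) ℕ.* h c) (c ℕ.* h c) ⟩
    suc c ℕ.* h (suc c) ℕ.+ ((i ∸ c) ℕ.* h c ℕ.+ c ℕ.* h c)
      ≡⟨ cong (suc c ℕ.* h (suc c) ℕ.+_) (ℕ.*-distribʳ-+ (h c) (i ∸ c) c) ⟨
    suc c ℕ.* h (suc c) ℕ.+ (i ∸ c ℕ.+ c) ℕ.* h c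
      ≡⟨ cong (λ x → suc c ℕ.* h (suc c) ℕ.+ x ℕ.* h c) (ℕ.m∸n+n≡m c≤i) ⟩
    suc c ℕ.* h (suc c) ℕ.+ i ℕ.* h c ∎
    where h = completions r (suc i)

  -- Summing `completions-suc` over c < l telescopes up to a boundary term at l. The additive form
  -- also covers l = i + 1, where the coefficient i - l is -1; `topCompletions-gap` reaches this
  -- case at m = i.
  topCompletions-suc : ∀ r {i} l → l ≤ suc i →
    topCompletions (suc r) i l ℕ.+ l ℕ.* topCompletions r (suc i) l ≡
    i ℕ.* topCompletions r (suc i) l ℕ.+ l ℕ.* topCompletions r (suc i) (suc l)
  topCompletions-suc r {i} zero    _   = base i
    where
    base : ∀ i → 0 ≡ i ℕ.* 0 ℕ.+ 0
    base = ℕ-ring.solve-∀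
  topCompletions-suc r {i} (suc l) l≤i = begin
    S ℕ.+ G ℕ.+ suc l ℕ.* (s ℕ.+ h)         ≡⟨ shuffle S G l s h ⟩
    (S ℕ.+ l ℕ.* s) ℕ.+ (G ℕ.+ l ℕ.* h) ℕ.+ (s ℕ.+ h)
      ≡⟨ cong₂ (λ x y → x ℕ.+ y ℕ.+ (s ℕ.+ h)) (topCompletions-suc r l (ℕ.≤-trans (ℕ.n≤1+n l) l≤i)) (completions-suc r (s≤s⁻¹ l≤i)) ⟩
    (i ℕ.* s ℕ.+ l ℕ.* (s ℕ.+ h)) ℕ.+ (suc l ℕ.* h′ ℕ.+ i ℕ.* h) ℕ.+ (s ℕ.+ h)
                                    ≡⟨ collect i l s h h′ ⟩
    i ℕ.* (s ℕ.+ h) ℕ.+ suc l ℕ.* (s ℕ.+ h ℕ.+ h′) ∎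
    where
    S = topCompletions (suc r) i l
    G = completions (suc r) i l
    s = topCompletions r (suc i) l
    h = completions r (suc i) l
    h′ = completions r (suc i) (suc l)
    shuffle : ∀ S G l s h → S ℕ.+ G ℕ.+ suc l ℕ.* (s ℕ.+ h) ≡ (S ℕ.+ l ℕ.* s) ℕ.+ (G ℕ.+ l ℕ.* h) ℕ.+ (s ℕ.+ h)
    shuffle = ℕ-ring.solve-∀
    collect : ∀ i l s h h′ →
      (i ℕ.* s ℕ.+ l ℕ.* (s ℕ.+ h)) ℕ.+ (suc l ℕ.* h′ ℕ.+ i ℕ.* h) ℕ.+ (s ℕ.+ h) ≡
      i ℕ.* (s ℕ.+ h) ℕ.+ suc l ℕ.* (s ℕ.+ h ℕ.+ h′)
    collect = ℕ-ring.solve-∀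

  topCompletions-end : ∀ i l → topCompletions 0 i l ≡ l ⊓ k
  topCompletions-end i zero    = refl
  topCompletions-end i (suc l) with l ℕ.<? k
  ... | yes l<k = begin
    topCompletions 0 i l ℕ.+ ⟦ l ℕ.<? k ⟧
      ≡⟨ cong₂ ℕ._+_ (trans (topCompletions-end i l) (ℕ.m≤n⇒m⊓n≡m (ℕ.<⇒≤ l<k))) (cong (if_then 1 else 0) (dec-true (l ℕ.<? k) l<k)) ⟩
    l ℕ.+ 1                             ≡⟨ ℕ.+-comm l 1 ⟩
    suc l                             ≡⟨ ℕ.m≤n⇒m⊓n≡m l<k ⟨
    suc l ⊓ k                         ∎
  ... | no  l≮k = begin
    topCompletions 0 i l ℕ.+ ⟦ l ℕ.<? k ⟧
      ≡⟨ cong₂ ℕ._+_ (trans (topCompletions-end i l) (ℕ.m≥n⇒m⊓n≡n (ℕ.≮⇒≥ l≮k))) (cong (if_then 1 else 0) (dec-false (l ℕ.<? k) l≮k)) ⟩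
    k ℕ.+ 0                             ≡⟨ ℕ.+-identityʳ k ⟩
    k                                 ≡⟨ ℕ.m≥n⇒m⊓n≡n (ℕ.m≤n⇒m≤1+n (ℕ.≮⇒≥ l≮k)) ⟨
    suc l ⊓ k                         ∎

module Values {A : ℕ → ℕ → Set} (A? : B.Decidable A) (k : ℕ) where
  open Play A?
  open Ranks k

  -- After a selection the rule no longer acts. The shift by one reflects that `successes r i` ends
  -- at r + i + 1 candidates and `completions r i` at r + i.
  successes-just : ∀ r i c → successes k r i (just c) ≡ completions (suc r) i c
  successes-just zero    i c = refl
  successes-just (suc r) i c = Σ<-cong (suc i) λ j _ → successes-just r (suc i) (bump j c)

  -- The last candidate is taken by default, and its relative rank is already its final rank.
  successes-end : ∀ {i} → k ≤ i → successes k 0 i nothing ≡ k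
  successes-end {i} k≤i = trans (topCompletions-end 0 (suc i)) (ℕ.m≥n⇒m⊓n≡n (ℕ.m≤n⇒m≤1+n k≤i))

  successes-suc : ∀ r {i l} → l ≤ suc i → (∀ j → j < l → A i (suc j)) → (∀ j → l ≤ j → ¬ A i (suc j)) →
    successes k (suc r) i nothing ≡
    topCompletions (suc r) (suc i) l ℕ.+ (suc i ∸ l) ℕ.* successes k r (suc i) nothing
  successes-suc r {i} {l} l≤1+i yes-A no-A = begin
    Σ< (suc i) h               ≡⟨ cong (λ x → Σ< x h) (ℕ.m+[n∸m]≡n l≤1+i) ⟨
    Σ< (l ℕ.+ (suc i ∸ l)) h     ≡⟨ Σ<-split l (suc i ∸ l)
      (λ j j<l → trans (cong (λ b → successes k r (suc i) (if b then just j else nothing)) (dec-true (A? i (suc j)) (yes-A j j<l)))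
                       (successes-just r (suc i) j))
      (λ j l≤j → cong (λ b → successes k r (suc i) (if b then just j else nothing)) (dec-false (A? i (suc j)) (no-A j l≤j))) ⟩
    topCompletions (suc r) (suc i) l ℕ.+ (suc i ∸ l) ℕ.* successes k r (suc i) nothing ∎
    where h = λ j → successes k r (suc i) (advance i j nothing)

-- Rational numbers and binomial coefficients

ℚ-ring : AlmostCommutativeRing 0ℓ 0ℓ
ℚ-ring = fromCommutativeRing ℚ.+-*-commutativeRing isZero
  where
  isZero : ∀ x → Maybe (0ℚ ≡ x)
  isZero x with 0ℚ ℚ.≟ x
  ... | yes p = just p
  ... | no _  = nothing

toℚᵘ-/ : ∀ i d → toℚᵘ (i / suc d) ℚᵘ.≃ mkℚᵘ i d
toℚᵘ-/ i d = ℚ.toℚᵘ-fromℚᵘ (mkℚᵘ i d)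

ιℤ : ℤ → ℚ
ιℤ i = i / 1

ιℤ-+ : ∀ i j → ιℤ (i ℤ.+ j) ≡ ιℤ i + ιℤ j
ιℤ-+ i j = ℚ.toℚᵘ-injective (begin′
  toℚᵘ (ιℤ (i ℤ.+ j))           ≈⟨ toℚᵘ-/ (i ℤ.+ j) 0 ⟩
  mkℚᵘ (i ℤ.+ j) 0              ≈⟨ *≡* (eq i j) ⟩
  mkℚᵘ i 0 ℚᵘ.+ mkℚᵘ j 0        ≈⟨ ℚᵘ.+-cong (toℚᵘ-/ i 0) (toℚᵘ-/ j 0) ⟨
  toℚᵘ (ιℤ i) ℚᵘ.+ toℚᵘ (ιℤ j)  ≈⟨ ℚ.toℚᵘ-homo-+ (ιℤ i) (ιℤ j) ⟨
  toℚᵘ (ιℤ i + ιℤ j)            ∎′)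
  where
  open SetoidReasoning ℚᵘ.≃-setoid renaming (begin_ to begin′_; _∎ to _∎′)
  eq : ∀ i j → (i ℤ.+ j) ℤ.* 1ℤ ≡ (i ℤ.* 1ℤ ℤ.+ j ℤ.* 1ℤ) ℤ.* 1ℤ
  eq = ℤ-ring.solve-∀

ιℤ-* : ∀ i j → ιℤ (i ℤ.* j) ≡ ιℤ i * ιℤ j
ιℤ-* i j = ℚ.toℚᵘ-injective (begin′
  toℚᵘ (ιℤ (i ℤ.* j))           ≈⟨ toℚᵘ-/ (i ℤ.* j) 0 ⟩
  mkℚᵘ (i ℤ.* j) 0              ≈⟨ *≡* refl ⟩
  mkℚᵘ i 0 ℚᵘ.* mkℚᵘ j 0        ≈⟨ ℚᵘ.*-cong (toℚᵘ-/ i 0) (toℚᵘ-/ j 0) ⟨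
  toℚᵘ (ιℤ i) ℚᵘ.* toℚᵘ (ιℤ j)  ≈⟨ ℚ.toℚᵘ-homo-* (ιℤ i) (ιℤ j) ⟨
  toℚᵘ (ιℤ i * ιℤ j)            ∎′)
  where open SetoidReasoning ℚᵘ.≃-setoid renaming (begin_ to begin′_; _∎ to _∎′)

ι-+ : ∀ a b → ι (a ℕ.+ b) ≡ ι a + ι b
ι-+ a b = ιℤ-+ (+ a) (+ b)

ι-* : ∀ a b → ι (a ℕ.* b) ≡ ι a * ι b
ι-* a b = trans (cong ιℤ (ℤ.pos-* a b)) (ιℤ-* (+ a) (+ b))

ι-suc : ∀ a → ι (suc a) ≡ 1ℚ + ι a
ι-suc a = ι-+ 1 a

ι-∸ : ∀ {a b} → b ≤ a → ι (a ∸ b) ≡ ι a - ι b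
ι-∸ {a} {b} b≤a = begin
  ι (a ∸ b)                ≡⟨ add-sub (ι (a ∸ b)) (ι b) ⟩
  ι (a ∸ b) + ι b - ι b    ≡⟨ cong (_- ι b) (ι-+ (a ∸ b) b) ⟨
  ι (a ∸ b ℕ.+ b) - ι b    ≡⟨ cong (λ x → ι x - ι b) (ℕ.m∸n+n≡m b≤a) ⟩
  ι a - ι b                ∎
  where
  add-sub : ∀ x y → x ≡ x + y - y
  add-sub = solve-∀ ℚ-ring

ιℤ-neg : ∀ i → ιℤ (ℤ.- i) ≡ - ιℤ i
ιℤ-neg i = begin
  ιℤ (ℤ.- i)                       ≡⟨ add-sub (ιℤ (ℤ.- i)) (ιℤ i) ⟩
  ιℤ (ℤ.- i) + ιℤ i - ιℤ i         ≡⟨ cong (_- ιℤ i) (ιℤ-+ (ℤ.- i) i) ⟨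
  ιℤ (ℤ.- i ℤ.+ i) - ιℤ i          ≡⟨ cong (λ x → ιℤ x - ιℤ i) (ℤ.+-inverseˡ i) ⟩
  0ℚ - ιℤ i                        ≡⟨ ℚ.+-identityˡ _ ⟩
  - ιℤ i                           ∎
  where
  add-sub : ∀ x y → x ≡ x + y - y
  add-sub = solve-∀ ℚ-ring

ιℤ-- : ∀ i j → ιℤ (i ℤ.- j) ≡ ιℤ i - ιℤ j
ιℤ-- i j = trans (ιℤ-+ i (ℤ.- j)) (cong (λ x → ιℤ i + x) (ιℤ-neg j))

/-*-ι : ∀ i d .{{_ : NonZero d}} → (i / d) * ι d ≡ ιℤ i
/-*-ι i (suc d) = ℚ.toℚᵘ-injective (begin′
  toℚᵘ (i / suc d * ι (suc d))              ≈⟨ ℚ.toℚᵘ-homo-* (i / suc d) (ι (suc d)) ⟩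
  toℚᵘ (i / suc d) ℚᵘ.* toℚᵘ (ι (suc d))    ≈⟨ ℚᵘ.*-cong (toℚᵘ-/ i d) (toℚᵘ-/ (+ suc d) 0) ⟩
  mkℚᵘ i d ℚᵘ.* mkℚᵘ (+ suc d) 0
    ≈⟨ *≡* (trans (ℤ.*-identityʳ _) (cong (λ x → i ℤ.* (+ x)) (sym (ℕ.*-identityʳ (suc d))))) ⟩
  mkℚᵘ i 0                                  ≈⟨ toℚᵘ-/ i 0 ⟨
  toℚᵘ (ιℤ i)                               ∎′)
  where open SetoidReasoning ℚᵘ.≃-setoid renaming (begin_ to begin′_; _∎ to _∎′)

*-cancelʳ-inv : ∀ c {c⁻ x y} → c⁻ * c ≡ 1ℚ → x * c ≡ y * c → x ≡ y
*-cancelʳ-inv c {c⁻} {x} {y} inv eq = begin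
  x              ≡⟨ expand x ⟩
  x * c * c⁻     ≡⟨ cong (_* c⁻) eq ⟩
  y * c * c⁻     ≡⟨ expand y ⟨
  y              ∎
  where
  assoc : ∀ z c c⁻ → z * (c⁻ * c) ≡ z * c * c⁻
  assoc = solve-∀ ℚ-ring
  expand : ∀ z → z ≡ z * c * c⁻
  expand z = begin
    z                ≡⟨ ℚ.*-identityʳ z ⟨
    z * 1ℚ           ≡⟨ cong (z *_) inv ⟨
    z * (c⁻ * c)     ≡⟨ assoc z c c⁻ ⟩
    z * c * c⁻       ∎

recip : ∀ d .{{_ : NonZero d}} → ℚ
recip d = + 1 / d

recip-*-ι : ∀ d .{{_ : NonZero d}} → recip d * ι d ≡ 1ℚ
recip-*-ι d = /-*-ι (+ 1) d

*-cancelʳ-ι : ∀ d .{{_ : NonZero d}} {x y} → x * ι d ≡ y * ι d → x ≡ y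
*-cancelʳ-ι d = *-cancelʳ-inv (ι d) {recip d} (recip-*-ι d)

/≡*recip : ∀ i d .{{_ : NonZero d}} → i / d ≡ ιℤ i * recip d
/≡*recip i d = *-cancelʳ-ι d (begin
  i / d * ι d             ≡⟨ /-*-ι i d ⟩
  ιℤ i                    ≡⟨ ℚ.*-identityʳ _ ⟨
  ιℤ i * 1ℚ               ≡⟨ cong (ιℤ i *_) (recip-*-ι d) ⟨
  ιℤ i * (recip d * ι d)  ≡⟨ ℚ.*-assoc (ιℤ i) (recip d) (ι d) ⟨
  ιℤ i * recip d * ι d    ∎)

recip-* : ∀ a b .{{_ : NonZero a}} .{{_ : NonZero b}} .{{_ : NonZero (a ℕ.* b)}} →
          recip (a ℕ.* b) ≡ recip a * recip b
recip-* a b = *-cancelʳ-ι (a ℕ.* b) (begin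
  recip (a ℕ.* b) * ι (a ℕ.* b)            ≡⟨ recip-*-ι (a ℕ.* b) ⟩
  1ℚ * 1ℚ                                  ≡⟨ cong₂ _*_ (recip-*-ι a) (recip-*-ι b) ⟨
  recip a * ι a * (recip b * ι b)          ≡⟨ interchange (recip a) (ι a) (recip b) (ι b) ⟩
  recip a * recip b * (ι a * ι b)          ≡⟨ cong (recip a * recip b *_) (ι-* a b) ⟨
  recip a * recip b * ι (a ℕ.* b)          ∎)
  where
  interchange : ∀ a b c d → a * b * (c * d) ≡ a * c * (b * d)
  interchange = solve-∀ ℚ-ring

recip! : ℕ → ℚ
recip! m = (+ 1) /! m

/!≡*recip! : ∀ i m → i /! m ≡ ιℤ i * recip! m
/!≡*recip! i m = /≡*recip i (m !) {{m ℕ.!≢0}}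

recip!-*-ι : ∀ m → recip! m * ι (m !) ≡ 1ℚ
recip!-*-ι m = recip-*-ι (m !) {{m ℕ.!≢0}}

/!-*-ι : ∀ i m → (i /! m) * ι (m !) ≡ ιℤ i
/!-*-ι i m = /-*-ι i (m !) {{m ℕ.!≢0}}

*-cancelʳ-! : ∀ m {x y} → x * ι (m !) ≡ y * ι (m !) → x ≡ y
*-cancelʳ-! m = *-cancelʳ-ι (m !) {{m ℕ.!≢0}}

ι-! : ∀ m → ι (suc m !) ≡ ι (suc m) * ι (m !)
ι-! m = ι-* (suc m) (m !)

binom-suc : ∀ a b → ι (suc b) * binom a (+ suc b) ≡ (ιℤ a - ι b) * binom a (+ b)
binom-suc a b = *-cancelʳ-! b (begin
  ι (suc b) * (fall a (suc b) /! suc b) * ι (b !)     ≡⟨ swap (ι (suc b)) (fall a (suc b) /! suc b) (ι (b !)) ⟩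
  (fall a (suc b) /! suc b) * (ι (suc b) * ι (b !))   ≡⟨ cong ((fall a (suc b) /! suc b) *_) (ι-! b) ⟨
  (fall a (suc b) /! suc b) * ι (suc b !)             ≡⟨ /!-*-ι (fall a (suc b)) (suc b) ⟩
  ιℤ (fall a b ℤ.* (a ℤ.- + b))                       ≡⟨ ιℤ-* (fall a b) (a ℤ.- + b) ⟩
  ιℤ (fall a b) * ιℤ (a ℤ.- + b)                      ≡⟨ cong₂ _*_ (/!-*-ι (fall a b) b) (sym (ιℤ-- a (+ b))) ⟨
  (fall a b /! b) * ι (b !) * (ιℤ a - ι b)            ≡⟨ swap′ (fall a b /! b) (ι (b !)) (ιℤ a - ι b) ⟩
  (ιℤ a - ι b) * (fall a b /! b) * ι (b !)            ∎)
  where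
  swap : ∀ x y z → x * y * z ≡ y * (x * z)
  swap = solve-∀ ℚ-ring
  swap′ : ∀ x y z → x * y * z ≡ z * x * y
  swap′ = solve-∀ ℚ-ring

-- At b = -1 the left factor is zero, and below that both coefficients are. The convention for
-- negative lower indices thus keeps the recurrence valid at the index i - m - 1 that occurs in
-- `tail-suc`.
binom-sucℤ : ∀ a b → (ιℤ b + 1ℚ) * binom a (b ℤ.+ 1ℤ) ≡ (ιℤ a - ιℤ b) * binom a b
binom-sucℤ a (+ b) = begin
  (ι b + 1ℚ) * binom a (+ b ℤ.+ 1ℤ)
    ≡⟨ cong₂ (λ x y → x * binom a (+ y)) (trans (ℚ.+-comm (ι b) 1ℚ) (sym (ι-suc b))) (ℕ.+-comm b 1) ⟩
  ι (suc b) * binom a (+ suc b)       ≡⟨ binom-suc a b ⟩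
  (ιℤ a - ι b) * binom a (+ b)        ∎
binom-sucℤ a -[1+ zero ]  = trans (ℚ.*-zeroˡ (binom a (+ 0))) (sym (ℚ.*-zeroʳ (ιℤ a - ιℤ -[1+ 0 ])))
binom-sucℤ a -[1+ suc b ] = trans (ℚ.*-zeroʳ (ιℤ -[1+ suc b ] + 1ℚ)) (sym (ℚ.*-zeroʳ (ιℤ a - ιℤ -[1+ suc b ])))

-- An identity of polynomials in `a`, hence the induction on the lower index. Together with
-- `binom-suc` it gives Pascal's rule and `binom-up` for every integer `a`.
binom-absorb : ∀ a b → ι (suc b) * binom (a ℤ.+ 1ℤ) (+ suc b) ≡ (ιℤ a + 1ℚ) * binom a (+ b)
binom-absorb a zero = begin
  ι 1 * binom (a ℤ.+ 1ℤ) (+ 1)             ≡⟨ binom-suc (a ℤ.+ 1ℤ) 0 ⟩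
  (ιℤ (a ℤ.+ 1ℤ) - ι 0) * binom a (+ 0)    ≡⟨ cong (λ x → (x - 0ℚ) * 1ℚ) (ιℤ-+ a 1ℤ) ⟩
  (ιℤ a + 1ℚ - 0ℚ) * 1ℚ                    ≡⟨ cong (_* 1ℚ) (ℚ.+-identityʳ (ιℤ a + 1ℚ)) ⟩
  (ιℤ a + 1ℚ) * 1ℚ                         ∎
binom-absorb a (suc b) = *-cancelʳ-ι (suc b) (begin
  ι (2 ℕ.+ b) * binom a⁺ (+ (2 ℕ.+ b)) * ι (suc b)
    ≡⟨ cong (_* ι (suc b)) (binom-suc a⁺ (suc b)) ⟩
  (ιℤ a⁺ - ι (suc b)) * binom a⁺ (+ suc b) * ι (suc b)
    ≡⟨ swap (ιℤ a⁺ - ι (suc b)) (binom a⁺ (+ suc b)) (ι (suc b)) ⟩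
  (ιℤ a⁺ - ι (suc b)) * (ι (suc b) * binom a⁺ (+ suc b))
    ≡⟨ cong₂ _*_ (cong₂ _-_ (ιℤ-+ a 1ℤ) (ι-suc b)) (binom-absorb a b) ⟩
  (ιℤ a + 1ℚ - (1ℚ + ι b)) * ((ιℤ a + 1ℚ) * binom a (+ b))
    ≡⟨ arrange (ιℤ a) (ι b) (binom a (+ b)) ⟩
  (ιℤ a + 1ℚ) * ((ιℤ a - ι b) * binom a (+ b))
    ≡⟨ cong ((ιℤ a + 1ℚ) *_) (binom-suc a b) ⟨
  (ιℤ a + 1ℚ) * (ι (suc b) * binom a (+ suc b))
    ≡⟨ swap (ιℤ a + 1ℚ) (binom a (+ suc b)) (ι (suc b)) ⟨
  (ιℤ a + 1ℚ) * binom a (+ suc b) * ι (suc b) ∎)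
  where
  a⁺ = a ℤ.+ 1ℤ
  swap : ∀ x y z → x * y * z ≡ x * (z * y)
  swap = solve-∀ ℚ-ring
  arrange : ∀ a b c → (a + 1ℚ - (1ℚ + b)) * ((a + 1ℚ) * c) ≡ (a + 1ℚ) * ((a - b) * c)
  arrange = solve-∀ ℚ-ring

binom-pascal : ∀ a b → binom (a ℤ.+ 1ℤ) (+ suc b) ≡ binom a (+ b) + binom a (+ suc b)
binom-pascal a b = *-cancelʳ-ι (suc b) (begin
  binom (a ℤ.+ 1ℤ) (+ suc b) * ι (suc b)      ≡⟨ ℚ.*-comm _ (ι (suc b)) ⟩
  ι (suc b) * binom (a ℤ.+ 1ℤ) (+ suc b)      ≡⟨ binom-absorb a b ⟩
  (ιℤ a + 1ℚ) * B                             ≡⟨ arrange (ιℤ a) (ι b) B ⟩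
  B * (1ℚ + ι b) + (ιℤ a - ι b) * B           ≡⟨ cong₂ _+_ (cong (B *_) (sym (ι-suc b))) (sym (binom-suc a b)) ⟩
  B * ι (suc b) + ι (suc b) * B′              ≡⟨ factor B B′ (ι (suc b)) ⟩
  (B + B′) * ι (suc b)                        ∎)
  where
  B = binom a (+ b)
  B′ = binom a (+ suc b)
  arrange : ∀ a b c → (a + 1ℚ) * c ≡ c * (1ℚ + b) + (a - b) * c
  arrange = solve-∀ ℚ-ring
  factor : ∀ x y z → x * z + z * y ≡ (x + y) * z
  factor = solve-∀ ℚ-ring

binom-up : ∀ a b → (ιℤ a + 1ℚ) * binom a (+ b) ≡ (ιℤ a + 1ℚ - ι b) * binom (a ℤ.+ 1ℤ) (+ b)
binom-up a b = begin
  (ιℤ a + 1ℚ) * binom a (+ b)                    ≡⟨ binom-absorb a b ⟨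
  ι (suc b) * binom (a ℤ.+ 1ℤ) (+ suc b)         ≡⟨ binom-suc (a ℤ.+ 1ℤ) b ⟩
  (ιℤ (a ℤ.+ 1ℤ) - ι b) * binom (a ℤ.+ 1ℤ) (+ b) ≡⟨ cong (λ x → (x - ι b) * binom (a ℤ.+ 1ℤ) (+ b)) (ιℤ-+ a 1ℤ) ⟩
  (ιℤ a + 1ℚ - ι b) * binom (a ℤ.+ 1ℤ) (+ b)     ∎

∑-toℕ-suc : ∀ m (f : ℕ → ℚ) → ∑ {suc m} (f ∘ toℕ) ≡ ∑ {m} (f ∘ toℕ) + f m
∑-toℕ-suc m f = trans (∑-init-last {m} (f ∘ toℕ))
  (cong₂ _+_ (∑-cong {m} (cong f ∘ Fin.toℕ-inject₁)) (cong f (Fin.toℕ-fromℕ m)))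

ι-≡+ : ∀ {a b c} → a ℕ.+ b ≡ c → ι c ≡ ι a + ι b
ι-≡+ {a} {b} eq = trans (cong ι (sym eq)) (ι-+ a b)

binom-< : ∀ {a b} → a < b → binom (+ a) (+ b) ≡ 0ℚ
binom-< {a} {suc b} a<1+b = *-cancelʳ-ι (suc b) (begin
  binom (+ a) (+ suc b) * ι (suc b)   ≡⟨ ℚ.*-comm _ (ι (suc b)) ⟩
  ι (suc b) * binom (+ a) (+ suc b)   ≡⟨ binom-suc (+ a) b ⟩
  (ι a - ι b) * binom (+ a) (+ b)     ≡⟨ vanish ⟩
  0ℚ                                  ≡⟨ ℚ.*-zeroˡ (ι (suc b)) ⟨
  0ℚ * ι (suc b)                      ∎)
  where
  vanish : (ι a - ι b) * binom (+ a) (+ b) ≡ 0ℚ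
  vanish with ℕ.m<1+n⇒m<n∨m≡n a<1+b
  ... | inj₁ a<b  = trans (cong ((ι a - ι b) *_) (binom-< a<b)) (ℚ.*-zeroʳ (ι a - ι b))
  ... | inj₂ refl = trans (cong (_* binom (+ a) (+ b)) (ℚ.+-inverseʳ (ι a))) (ℚ.*-zeroˡ (binom (+ a) (+ b)))

+suc : ∀ a → + a ℤ.+ 1ℤ ≡ + suc a
+suc a = cong +_ (ℕ.+-comm a 1)

binom-diag : ∀ a → binom (+ a) (+ a) ≡ 1ℚ
binom-diag zero    = refl
binom-diag (suc a) = begin
  binom (+ suc a) (+ suc a)                   ≡⟨ cong (λ x → binom x (+ suc a)) (+suc a) ⟨
  binom (+ a ℤ.+ 1ℤ) (+ suc a)                ≡⟨ binom-pascal (+ a) a ⟩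
  binom (+ a) (+ a) + binom (+ a) (+ suc a)   ≡⟨ cong₂ _+_ (binom-diag a) (binom-< (ℕ.n<1+n a)) ⟩
  1ℚ                                          ∎

-- Closed forms for the completion counts, with b = n - k

module Closed (k′ b : ℕ) where

  k n : ℕ
  k = suc k′
  n = suc (k′ ℕ.+ b)
  open Ranks k

  S : (r i l : ℕ) → ℚ
  S r i l = ι (topCompletions r i l)

  S-suc : ∀ r {i} l → l ≤ suc i → S (suc r) i l ≡ (ι i - ι l) * S r (suc i) l + ι l * S r (suc i) (suc l)
  S-suc r {i} l l≤1+i = begin
    S (suc r) i l                                      ≡⟨ add-sub (S (suc r) i l) (ι l * s) ⟩
    S (suc r) i l + ι l * s - ι l * s                  ≡⟨ cong (_- ι l * s) cast ⟩
    ι i * s + ι l * s′ - ι l * s                       ≡⟨ arrange (ι i) (ι l) s s′ ⟩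
    (ι i - ι l) * s + ι l * s′                         ∎
    where
    s = S r (suc i) l
    s′ = S r (suc i) (suc l)
    cast : S (suc r) i l + ι l * s ≡ ι i * s + ι l * s′
    cast = begin
      S (suc r) i l + ι l * s    ≡⟨ cong (λ x → S (suc r) i l + x) (ι-* l _) ⟨
      S (suc r) i l + ι (l ℕ.* topCompletions r (suc i) l)   ≡⟨ ι-+ (topCompletions (suc r) i l) _ ⟨
      ι (topCompletions (suc r) i l ℕ.+ l ℕ.* topCompletions r (suc i) l)  ≡⟨ cong ι (topCompletions-suc r l l≤1+i) ⟩
      ι (i ℕ.* topCompletions r (suc i) l ℕ.+ l ℕ.* topCompletions r (suc i) (suc l))
        ≡⟨ ι-+ (i ℕ.* topCompletions r (suc i) l) _ ⟩
      ι (i ℕ.* topCompletions r (suc i) l) + ι (l ℕ.* topCompletions r (suc i) (suc l)) ≡⟨ cong₂ _+_ (ι-* i _) (ι-* l _) ⟩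
      ι i * s + ι l * s′ ∎
    add-sub : ∀ x y → x ≡ x + y - y
    add-sub = solve-∀ ℚ-ring
    arrange : ∀ i l s s′ → i * s + l * s′ - l * s ≡ (i - l) * s + l * s′
    arrange = solve-∀ ℚ-ring

  -- Fix one of the k best candidates. This counts the sets of i candidates that contain it together
  -- with exactly j of the other k - 1 best; `tail m i` admits fewer than m of those others.
  term : (i j : ℕ) → ℚ
  term i j = binom (+ k′) (+ j) * binom (+ b) (+ i ℤ.- + j ℤ.- 1ℤ)

  tail : (m i : ℕ) → ℚ
  tail m i = ∑ {m} (λ j → term i (toℕ j))

  -- Without the truncation at m this is (n − i) C(n−1, i−1) = i C(n−1, i).
  tail-suc : ∀ m i → (ι n - ι i) * tail m i ≡ ι i * tail m (suc i) + ι m * term (suc i) m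
  tail-suc zero i = begin
    (ι n - ι i) * 0ℚ                ≡⟨ ℚ.*-zeroʳ (ι n - ι i) ⟩
    0ℚ                              ≡⟨ cong₂ _+_ (ℚ.*-zeroʳ (ι i)) (ℚ.*-zeroˡ (term (suc i) 0)) ⟨
    ι i * 0ℚ + 0ℚ * term (suc i) 0  ∎
  tail-suc (suc m) i = begin
    (ι n - ι i) * tail (suc m) i
      ≡⟨ cong ((ι n - ι i) *_) (∑-toℕ-suc m (term i)) ⟩
    (ι n - ι i) * (tail m i + A * B)
      ≡⟨ ℚ.*-distribˡ-+ (ι n - ι i) (tail m i) (A * B) ⟩
    (ι n - ι i) * tail m i + (ι n - ι i) * (A * B)
      ≡⟨ cong₂ _+_ (tail-suc m i) (cong (λ x → (x - ι i) * (A * B)) n≡) ⟩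
    ι i * tail m (suc i) + ι m * term (suc i) m + (1ℚ + (ι k′ + ι b) - ι i) * (A * B)
      ≡⟨ cong (λ y → ι i * tail m (suc i) + ι m * (A * y) + (1ℚ + (ι k′ + ι b) - ι i) * (A * B)) (cong (binom (+ b)) z+1) ⟩
    ι i * tail m (suc i) + ι m * (A * B⁺) + (1ℚ + (ι k′ + ι b) - ι i) * (A * B)
      -- Two absorptions are isolated: (k′ - m) A becomes (m + 1) A⁺, and the last bracket vanishes
      -- by `binom-sucℤ` at the possibly negative index `z`.
      ≡⟨ expand (ι i) (ι m) (ι k′) (ι b) (tail m (suc i)) A B B⁺ ⟩
    ι i * (tail m (suc i) + A * B⁺) + (ι k′ - ι m) * A * B
      + A * ((ι b - (ι i - ι m - 1ℚ)) * B - (ι i - ι m - 1ℚ + 1ℚ) * B⁺)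
      ≡⟨ cong₂ (λ x y → ι i * (tail m (suc i) + A * B⁺) + x * B + A * y) (sym (binom-suc (+ k′) m)) ratio ⟩
    ι i * (tail m (suc i) + A * B⁺) + ι (suc m) * A⁺ * B + A * 0ℚ
      ≡⟨ cong (λ y → ι i * (tail m (suc i) + A * y) + ι (suc m) * A⁺ * B + A * 0ℚ) (cong (binom (+ b)) z+1) ⟨
    ι i * (tail m (suc i) + term (suc i) m) + ι (suc m) * A⁺ * B + A * 0ℚ
      ≡⟨ cong₂ (λ x y → ι i * x + y + A * 0ℚ) (sym (∑-toℕ-suc m (term (suc i)))) (ℚ.*-assoc (ι (suc m)) A⁺ B) ⟩
    ι i * tail (suc m) (suc i) + ι (suc m) * (A⁺ * B) + A * 0ℚ
      ≡⟨ cong (λ y → ι i * tail (suc m) (suc i) + ι (suc m) * (A⁺ * binom (+ b) y) + A * 0ℚ) shift ⟨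
    ι i * tail (suc m) (suc i) + ι (suc m) * term (suc i) (suc m) + A * 0ℚ
      ≡⟨ drop A _ ⟩
    ι i * tail (suc m) (suc i) + ι (suc m) * term (suc i) (suc m) ∎
    where
    z = + i ℤ.- + m ℤ.- 1ℤ
    A = binom (+ k′) (+ m)
    A⁺ = binom (+ k′) (+ suc m)
    B = binom (+ b) z
    B⁺ = binom (+ b) (z ℤ.+ 1ℤ)
    n≡ : ι n ≡ 1ℚ + (ι k′ + ι b)
    n≡ = trans (ι-suc (k′ ℕ.+ b)) (cong (λ x → 1ℚ + x) (ι-+ k′ b))
    z+1 : + suc i ℤ.- + m ℤ.- 1ℤ ≡ z ℤ.+ 1ℤ
    z+1 = eq (+ i) (+ m)
      where
      eq : ∀ i m → (1ℤ ℤ.+ i) ℤ.- m ℤ.- 1ℤ ≡ i ℤ.- m ℤ.- 1ℤ ℤ.+ 1ℤ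
      eq = ℤ-ring.solve-∀
    shift : + suc i ℤ.- + suc m ℤ.- 1ℤ ≡ z
    shift = eq (+ i) (+ m)
      where
      eq : ∀ i m → (1ℤ ℤ.+ i) ℤ.- (1ℤ ℤ.+ m) ℤ.- 1ℤ ≡ i ℤ.- m ℤ.- 1ℤ
      eq = ℤ-ring.solve-∀
    ιz : ιℤ z ≡ ι i - ι m - 1ℚ
    ιz = trans (ιℤ-- (+ i ℤ.- + m) 1ℤ) (cong (_- 1ℚ) (ιℤ-- (+ i) (+ m)))
    ratio : (ι b - (ι i - ι m - 1ℚ)) * B - (ι i - ι m - 1ℚ + 1ℚ) * B⁺ ≡ 0ℚ
    ratio = begin
      (ι b - (ι i - ι m - 1ℚ)) * B - (ι i - ι m - 1ℚ + 1ℚ) * B⁺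
        ≡⟨ cong (λ x → (ι b - x) * B - (x + 1ℚ) * B⁺) ιz ⟨
      (ι b - ιℤ z) * B - (ιℤ z + 1ℚ) * B⁺
        ≡⟨ cong (λ x → (ι b - ιℤ z) * B - x) (binom-sucℤ (+ b) z) ⟩
      (ι b - ιℤ z) * B - (ι b - ιℤ z) * B
        ≡⟨ ℚ.+-inverseʳ ((ι b - ιℤ z) * B) ⟩
      0ℚ ∎
    expand : ∀ i m k b t A B B⁺ →
      i * t + m * (A * B⁺) + (1ℚ + (k + b) - i) * (A * B) ≡
      i * (t + A * B⁺) + (k - m) * A * B + A * ((b - (i - m - 1ℚ)) * B - (i - m - 1ℚ + 1ℚ) * B⁺)
    expand = solve-∀ ℚ-ring
    drop : ∀ A x → x + A * 0ℚ ≡ x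
    drop = solve-∀ ℚ-ring

  -- At i = n the set contains everybody, so only j = k - 1 can occur. Hence `tail m n` is the
  -- indicator of m ≥ k.
  term-end-< : ∀ {j} → j < k′ → term n j ≡ 0ℚ
  term-end-< {j} j<k′ = trans
    (cong (binom (+ k′) (+ j) *_) (trans (cong (binom (+ b)) index) (binom-< (ℕ.m<m+n b (ℕ.m<n⇒0<n∸m j<k′)))))
    (ℚ.*-zeroʳ (binom (+ k′) (+ j)))
    where
    eq : ∀ j e b → (1ℤ ℤ.+ (j ℤ.+ e ℤ.+ b)) ℤ.- j ℤ.- 1ℤ ≡ b ℤ.+ e
    eq = ℤ-ring.solve-∀
    index : + n ℤ.- + j ℤ.- 1ℤ ≡ + (b ℕ.+ (k′ ∸ j))
    index = trans (cong (λ x → + suc (x ℕ.+ b) ℤ.- + j ℤ.- 1ℤ) (sym (ℕ.m+[n∸m]≡n (ℕ.<⇒≤ j<k′)))) (eq (+ j) (+ (k′ ∸ j)) (+ b))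

  term-end-≡ : term n k′ ≡ 1ℚ
  term-end-≡ = cong₂ _*_ (binom-diag k′) (trans (cong (binom (+ b)) (eq (+ k′) (+ b))) (binom-diag b))
    where
    eq : ∀ k b → (1ℤ ℤ.+ (k ℤ.+ b)) ℤ.- k ℤ.- 1ℤ ≡ b
    eq = ℤ-ring.solve-∀

  term-end-> : ∀ {j} → k′ < j → term n j ≡ 0ℚ
  term-end-> {j} k′<j = trans
    (cong (_* binom (+ b) (+ n ℤ.- + j ℤ.- 1ℤ)) (binom-< k′<j))
    (ℚ.*-zeroˡ (binom (+ b) (+ n ℤ.- + j ℤ.- 1ℤ)))

  tail-end-≤ : ∀ {m} → m ≤ k′ → tail m n ≡ 0ℚ
  tail-end-≤ {zero}  _    = refl
  tail-end-≤ {suc m} m<k′ = trans (∑-toℕ-suc m (term n)) (cong₂ _+_ (tail-end-≤ (ℕ.<⇒≤ m<k′)) (term-end-< m<k′))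

  tail-end-> : ∀ {m} → k′ < m → tail m n ≡ 1ℚ
  tail-end-> {suc m} k′<1+m = trans (∑-toℕ-suc m (term n)) (cong′ (ℕ.m<1+n⇒m<n∨m≡n k′<1+m))
    where
    cong′ : k′ < m ⊎ k′ ≡ m → tail m n + term n m ≡ 1ℚ
    cong′ (inj₁ k′<m) = cong₂ _+_ (tail-end-> k′<m) (term-end-> k′<m)
    cong′ (inj₂ refl) = cong₂ _+_ (tail-end-≤ ℕ.≤-refl) term-end-≡

  -- The left side is σ_m(i) minus m times the completions of the candidate of current rank m. Let B
  -- be the number of the k best among the first i. A choice of these i contributes min(m, B) - m if
  -- B > m, which is zero, and B otherwise. Summing B over the sets with B ≤ m means marking one of
  -- the k best in such a set, which gives k times `tail m i`; the other r candidates come in any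
  -- order.
  topCompletions-gap : ∀ r {i} m → i ℕ.+ r ≡ n → m ≤ i →
    ι (suc m) * S r i m - ι m * S r i (suc m) ≡ ι k * ι (r !) * tail m i
  topCompletions-gap zero {i} m i+0≡n _ rewrite trans (sym (ℕ.+-identityʳ i)) i+0≡n with k′ ℕ.<? m
  ... | yes k′<m = begin
    ι (suc m) * S 0 n m - ι m * S 0 n (suc m)
      ≡⟨ cong₂ (λ x y → ι (suc m) * ι x - ι m * ι y)
           (trans (topCompletions-end n m) (ℕ.m≥n⇒m⊓n≡n k′<m))
           (trans (topCompletions-end n (suc m)) (ℕ.m≥n⇒m⊓n≡n (ℕ.m<n⇒m<1+n k′<m))) ⟩
    ι (suc m) * ι k - ι m * ι k   ≡⟨ cong (λ x → x * ι k - ι m * ι k) (ι-suc m) ⟩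
    (1ℚ + ι m) * ι k - ι m * ι k  ≡⟨ arrange (ι m) (ι k) ⟩
    ι k * 1ℚ * 1ℚ                 ≡⟨ cong (ι k * 1ℚ *_) (tail-end-> k′<m) ⟨
    ι k * 1ℚ * tail m n           ∎
    where
    arrange : ∀ m k → (1ℚ + m) * k - m * k ≡ k * 1ℚ * 1ℚ
    arrange = solve-∀ ℚ-ring
  ... | no k′≮m = begin
    ι (suc m) * S 0 n m - ι m * S 0 n (suc m)
      ≡⟨ cong₂ (λ x y → ι (suc m) * ι x - ι m * ι y)
           (trans (topCompletions-end n m) (ℕ.m≤n⇒m⊓n≡m (ℕ.m≤n⇒m≤1+n (ℕ.≮⇒≥ k′≮m))))
           (trans (topCompletions-end n (suc m)) (ℕ.m≤n⇒m⊓n≡m (s≤s (ℕ.≮⇒≥ k′≮m)))) ⟩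
    ι (suc m) * ι m - ι m * ι (suc m)  ≡⟨ arrange (ι (suc m)) (ι m) (ι k) ⟩
    ι k * 1ℚ * 0ℚ                      ≡⟨ cong (ι k * 1ℚ *_) (tail-end-≤ (ℕ.≮⇒≥ k′≮m)) ⟨
    ι k * 1ℚ * tail m n                ∎
    where
    arrange : ∀ a b k → a * b - b * a ≡ k * 1ℚ * 0ℚ
    arrange = solve-∀ ℚ-ring
  topCompletions-gap (suc r) {i} m i+r≡n m≤i = begin
    ι (suc m) * S (suc r) i m - ι m * S (suc r) i (suc m)
      ≡⟨ cong₂ (λ x y → ι (suc m) * x - ι m * y) (S-suc r m (ℕ.m≤n⇒m≤1+n m≤i)) (S-suc r (suc m) (s≤s m≤i)) ⟩
    ι (suc m) * ((ι i - ι m) * A + ι m * B) - ι m * ((ι i - ι (suc m)) * B + ι (suc m) * C)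
      ≡⟨ cong (λ x → x * ((ι i - ι m) * A + ι m * B) - ι m * ((ι i - x) * B + x * C)) (ι-suc m) ⟩
    (1ℚ + ι m) * ((ι i - ι m) * A + ι m * B) - ι m * ((ι i - (1ℚ + ι m)) * B + (1ℚ + ι m) * C)
      -- The two recurrences recombine into the gaps at m and m + 1, with weights i - m and m, which
      -- is the combination that `tail-suc` contracts.
      ≡⟨ regroup (ι i) (ι m) A B C ⟩
    (ι i - ι m) * ((1ℚ + ι m) * A - ι m * B) + ι m * ((1ℚ + (1ℚ + ι m)) * B - (1ℚ + ι m) * C)
      ≡⟨ cong₂ (λ x y → (ι i - ι m) * (x * A - ι m * B) + ι m * (y * B - x * C)) (sym (ι-suc m))
           (trans (cong (λ x → 1ℚ + x) (sym (ι-suc m))) (sym (ι-suc (suc m)))) ⟩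
    (ι i - ι m) * (ι (suc m) * A - ι m * B) + ι m * (ι (suc (suc m)) * B - ι (suc m) * C)
      ≡⟨ cong₂ (λ x y → (ι i - ι m) * x + ι m * y)
           (topCompletions-gap r m i+r≡n′ (ℕ.m≤n⇒m≤1+n m≤i)) (topCompletions-gap r (suc m) i+r≡n′ (s≤s m≤i)) ⟩
    (ι i - ι m) * (K * T) + ι m * (K * tail (suc m) (suc i))
      ≡⟨ cong (λ x → (ι i - ι m) * (K * T) + ι m * (K * x)) (∑-toℕ-suc m (term (suc i))) ⟩
    (ι i - ι m) * (K * T) + ι m * (K * (T + term (suc i) m))
      ≡⟨ factor (ι i) (ι m) K T (term (suc i) m) ⟩
    K * (ι i * T + ι m * term (suc i) m)
      ≡⟨ cong (K *_) (tail-suc m i) ⟨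
    K * ((ι n - ι i) * tail m i)
      ≡⟨ cong (λ x → K * (x * tail m i)) n-i ⟩
    ι k * ι (r !) * (ι (suc r) * tail m i)
      ≡⟨ reassoc (ι k) (ι (r !)) (ι (suc r)) (tail m i) ⟩
    ι k * (ι (suc r) * ι (r !)) * tail m i
      ≡⟨ cong (λ x → ι k * x * tail m i) (ι-! r) ⟨
    ι k * ι (suc r !) * tail m i ∎
    where
    i+r≡n′ : suc i ℕ.+ r ≡ n
    i+r≡n′ = trans (sym (ℕ.+-suc i r)) i+r≡n
    A = S r (suc i) m
    B = S r (suc i) (suc m)
    C = S r (suc i) (suc (suc m))
    K = ι k * ι (r !)
    T = tail m (suc i)
    n-i : ι n - ι i ≡ ι (suc r)
    n-i = trans (cong (_- ι i) (ι-≡+ {i} {suc r} i+r≡n)) (cancel (ι i) (ι (suc r)))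
      where
      cancel : ∀ x y → x + y - x ≡ y
      cancel = solve-∀ ℚ-ring
    regroup : ∀ i m A B C →
      (1ℚ + m) * ((i - m) * A + m * B) - m * ((i - (1ℚ + m)) * B + (1ℚ + m) * C) ≡
      (i - m) * ((1ℚ + m) * A - m * B) + m * ((1ℚ + (1ℚ + m)) * B - (1ℚ + m) * C)
    regroup = solve-∀ ℚ-ring
    factor : ∀ i m K t u → (i - m) * (K * t) + m * (K * (t + u)) ≡ K * (i * t + m * u)
    factor = solve-∀ ℚ-ring
    reassoc : ∀ a b c d → a * b * (c * d) ≡ a * (c * b) * d
    reassoc = solve-∀ ℚ-ring

  C : ℚ
  C = binom (+ n) (+ k)

  -- Both sides are n! r! / ((k-1)! (n-k-i)!) when i ≤ n - k and zero beyond; induction on i avoids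
  -- the distinction. It turns the C(n-k, i) that the gap at m = 1 produces into the C(n-j-1, k-1)
  -- of d_0 and d_1.
  binom-ratio : ∀ i {r} → suc i ℕ.+ r ≡ n →
    ι (i !) * ι (r !) * ι k * binom (+ b) (+ i) * C ≡ ι (n !) * binom (+ r) (+ k′)
  binom-ratio zero refl = begin
    1ℚ * ι (r !) * ι k * 1ℚ * C            ≡⟨ arrange (ι (r !)) (ι k) C ⟩
    ι (r !) * (ι k * C)                    ≡⟨ cong (λ x → ι (r !) * (ι k * binom x (+ k))) (+suc r) ⟨
    ι (r !) * (ι k * binom (+ r ℤ.+ 1ℤ) (+ k))  ≡⟨ cong (ι (r !) *_) (binom-absorb (+ r) k′) ⟩
    ι (r !) * ((ι r + 1ℚ) * binom (+ r) (+ k′)) ≡⟨ arrange′ (ι (r !)) (ι r) (binom (+ r) (+ k′)) ⟩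
    (1ℚ + ι r) * ι (r !) * binom (+ r) (+ k′)   ≡⟨ cong (λ x → x * ι (r !) * binom (+ r) (+ k′)) (ι-suc r) ⟨
    ι n * ι (r !) * binom (+ r) (+ k′)     ≡⟨ cong (_* binom (+ r) (+ k′)) (ι-! r) ⟨
    ι (n !) * binom (+ r) (+ k′)           ∎
    where
    r = k′ ℕ.+ b
    arrange : ∀ r k c → 1ℚ * r * k * 1ℚ * c ≡ r * (k * c)
    arrange = solve-∀ ℚ-ring
    arrange′ : ∀ f r c → f * ((r + 1ℚ) * c) ≡ (1ℚ + r) * f * c
    arrange′ = solve-∀ ℚ-ring
  binom-ratio (suc i) {r} eq = *-cancelʳ-ι (suc r) (begin
    ι (suc i !) * ι (r !) * ι k * binom (+ b) (+ suc i) * C * ι (suc r)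
      ≡⟨ cong (λ x → x * ι (r !) * ι k * binom (+ b) (+ suc i) * C * ι (suc r)) (ι-! i) ⟩
    ι (suc i) * ι (i !) * ι (r !) * ι k * binom (+ b) (+ suc i) * C * ι (suc r)
      ≡⟨ arrange (ι (suc i)) (ι (i !)) (ι (r !)) (ι k) (binom (+ b) (+ suc i)) C (ι (suc r)) ⟩
    ι (i !) * (ι (suc r) * ι (r !)) * ι k * (ι (suc i) * binom (+ b) (+ suc i)) * C
      ≡⟨ cong₂ (λ x y → ι (i !) * x * ι k * y * C) (sym (ι-! r)) (binom-suc (+ b) i) ⟩
    ι (i !) * ι (suc r !) * ι k * ((ι b - ι i) * binom (+ b) (+ i)) * C
      ≡⟨ arrange′ (ι (i !)) (ι (suc r !)) (ι k) (ι b - ι i) (binom (+ b) (+ i)) C ⟩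
    (ι b - ι i) * (ι (i !) * ι (suc r !) * ι k * binom (+ b) (+ i) * C)
      ≡⟨ cong ((ι b - ι i) *_) (binom-ratio i (trans (ℕ.+-suc (suc i) r) eq)) ⟩
    (ι b - ι i) * (ι (n !) * binom (+ suc r) (+ k′))
      ≡⟨ cong (_* (ι (n !) * binom (+ suc r) (+ k′))) difference ⟩
    (ι r + 1ℚ - ι k′) * (ι (n !) * binom (+ suc r) (+ k′))
      ≡⟨ arrange″ (ι r + 1ℚ - ι k′) (ι (n !)) (binom (+ suc r) (+ k′)) ⟩
    ι (n !) * ((ι r + 1ℚ - ι k′) * binom (+ suc r) (+ k′))
      ≡⟨ cong (λ x → ι (n !) * ((ι r + 1ℚ - ι k′) * binom x (+ k′))) (+suc r) ⟨
    ι (n !) * ((ι r + 1ℚ - ι k′) * binom (+ r ℤ.+ 1ℤ) (+ k′))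
      ≡⟨ cong (ι (n !) *_) (binom-up (+ r) k′) ⟨
    ι (n !) * ((ι r + 1ℚ) * binom (+ r) (+ k′))
      ≡⟨ cong (λ x → ι (n !) * (x * binom (+ r) (+ k′))) (trans (ℚ.+-comm (ι r) 1ℚ) (sym (ι-suc r))) ⟩
    ι (n !) * (ι (suc r) * binom (+ r) (+ k′))
      ≡⟨ arrange‴ (ι (n !)) (ι (suc r)) (binom (+ r) (+ k′)) ⟩
    ι (n !) * binom (+ r) (+ k′) * ι (suc r) ∎)
    where
    difference : ι b - ι i ≡ ι r + 1ℚ - ι k′
    difference = begin
      ι b - ι i                                ≡⟨ add-sub (ι k′) (ι b) (ι i) ⟩
      (ι k′ + ι b) - ι k′ - ι i                ≡⟨ cong (λ x → x - ι k′ - ι i) (ι-+ k′ b) ⟨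
      ι (k′ ℕ.+ b) - ι k′ - ι i                ≡⟨ cong (λ x → ι x - ι k′ - ι i) (ℕ.suc-injective eq) ⟨
      ι (suc (i ℕ.+ r)) - ι k′ - ι i
        ≡⟨ cong (λ x → x - ι k′ - ι i) (trans (ι-suc (i ℕ.+ r)) (cong (λ x → 1ℚ + x) (ι-+ i r))) ⟩
      1ℚ + (ι i + ι r) - ι k′ - ι i            ≡⟨ cancel (ι i) (ι r) (ι k′) ⟩
      ι r + 1ℚ - ι k′                          ∎
      where
      add-sub : ∀ k b i → b - i ≡ (k + b) - k - i
      add-sub = solve-∀ ℚ-ring
      cancel : ∀ i r k → 1ℚ + (i + r) - k - i ≡ r + 1ℚ - k
      cancel = solve-∀ ℚ-ring
    arrange : ∀ s i r k β c t → s * i * r * k * β * c * t ≡ i * (t * r) * k * (s * β) * c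
    arrange = solve-∀ ℚ-ring
    arrange′ : ∀ i r k d β c → i * r * k * (d * β) * c ≡ d * (i * r * k * β * c)
    arrange′ = solve-∀ ℚ-ring
    arrange″ : ∀ d f β → d * (f * β) ≡ f * (d * β)
    arrange″ = solve-∀ ℚ-ring
    arrange‴ : ∀ f s β → f * (s * β) ≡ f * β * s
    arrange‴ = solve-∀ ℚ-ring

  -- The gap at m = 1 eliminates σ_2 from the recurrence of σ_1, leaving a recurrence in σ_1 alone.
  S₁-suc : ∀ r {i} → suc i ℕ.+ r ≡ n →
    S (suc r) i 1 ≡ ι (suc i) * S r (suc i) 1 - ι k * ι (r !) * binom (+ b) (+ i)
  S₁-suc r {i} eq = begin
    S (suc r) i 1
      ≡⟨ S-suc r {i} 1 (s≤s z≤n) ⟩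
    (ι i - 1ℚ) * s₁ + 1ℚ * s₂
      ≡⟨ arrange (ι i) s₁ s₂ ⟩
    (1ℚ + ι i) * s₁ - ((1ℚ + 1ℚ) * s₁ - 1ℚ * s₂)
      ≡⟨ cong₂ (λ x y → x * s₁ - y) (sym (ι-suc i)) (topCompletions-gap r 1 eq (s≤s z≤n)) ⟩
    ι (suc i) * s₁ - ι k * ι (r !) * (1ℚ * binom (+ b) (+ suc i ℤ.- + 0 ℤ.- 1ℤ) + 0ℚ)
      ≡⟨ cong (λ x → ι (suc i) * s₁ - ι k * ι (r !) * (1ℚ * binom (+ b) x + 0ℚ)) (shift (+ i)) ⟩
    ι (suc i) * s₁ - ι k * ι (r !) * (1ℚ * binom (+ b) (+ i) + 0ℚ)
      ≡⟨ cong (λ x → ι (suc i) * s₁ - ι k * ι (r !) * x) (trans (ℚ.+-identityʳ _) (ℚ.*-identityˡ _)) ⟩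
    ι (suc i) * s₁ - ι k * ι (r !) * binom (+ b) (+ i) ∎
    where
    s₁ = S r (suc i) 1
    s₂ = S r (suc i) 2
    arrange : ∀ i s₁ s₂ → (i - 1ℚ) * s₁ + 1ℚ * s₂ ≡ (1ℚ + i) * s₁ - ((1ℚ + 1ℚ) * s₁ - 1ℚ * s₂)
    arrange = solve-∀ ℚ-ring
    shift : ∀ i → (1ℤ ℤ.+ i) ℤ.- + 0 ℤ.- 1ℤ ≡ i
    shift = ℤ-ring.solve-∀

  S₁-scaled : ∀ r {i} → suc i ℕ.+ r ≡ n →
    ι (i !) * S (suc r) i 1 * C ≡ ι (suc i !) * S r (suc i) 1 * C - ι (n !) * binom (+ r) (+ k′)
  S₁-scaled r {i} eq = begin
    ι (i !) * S (suc r) i 1 * C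
      ≡⟨ cong (λ x → ι (i !) * x * C) (S₁-suc r eq) ⟩
    ι (i !) * (ι (suc i) * s - ι k * ι (r !) * binom (+ b) (+ i)) * C
      ≡⟨ arrange (ι (i !)) (ι (suc i)) s (ι k) (ι (r !)) (binom (+ b) (+ i)) C ⟩
    ι (suc i) * ι (i !) * s * C - ι (i !) * ι (r !) * ι k * binom (+ b) (+ i) * C
      ≡⟨ cong₂ (λ x y → x * s * C - y) (sym (ι-! i)) (binom-ratio i eq) ⟩
    ι (suc i !) * s * C - ι (n !) * binom (+ r) (+ k′) ∎
    where
    s = S r (suc i) 1
    arrange : ∀ f i s k r β c → f * (i * s - k * r * β) * c ≡ i * f * s * c - f * r * k * β * c
    arrange = solve-∀ ℚ-ring

  -- After division by n! C(n,k) this is the probability that the best of the first i is among the k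
  -- best, which fails exactly when all of these arrive later. The recurrence telescopes by Pascal's
  -- rule.
  S₁-closed : ∀ r {i} → i ℕ.+ r ≡ n → ι (i !) * S r i 1 * C ≡ ι (n !) * (C - binom (+ r) (+ k))
  S₁-closed zero {i} eq rewrite trans (sym (ℕ.+-identityʳ i)) eq = begin
    ι (n !) * S 0 n 1 * C              ≡⟨ cong (λ x → ι (n !) * ι x * C) (topCompletions-end n 1) ⟩
    ι (n !) * 1ℚ * C                   ≡⟨ arrange (ι (n !)) C ⟩
    ι (n !) * (C - 0ℚ)                 ≡⟨ cong (λ x → ι (n !) * (C - x)) (binom-< {0} {k} (s≤s z≤n)) ⟨
    ι (n !) * (C - binom (+ 0) (+ k))  ∎
    where
    arrange : ∀ f c → f * 1ℚ * c ≡ f * (c - 0ℚ)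
    arrange = solve-∀ ℚ-ring
  S₁-closed (suc r) {i} eq = begin
    ι (i !) * S (suc r) i 1 * C
      ≡⟨ S₁-scaled r eq′ ⟩
    ι (suc i !) * S r (suc i) 1 * C - ι (n !) * binom (+ r) (+ k′)
      ≡⟨ cong (_- ι (n !) * binom (+ r) (+ k′)) (S₁-closed r eq′) ⟩
    ι (n !) * (C - binom (+ r) (+ k)) - ι (n !) * binom (+ r) (+ k′)
      ≡⟨ arrange (ι (n !)) C (binom (+ r) (+ k)) (binom (+ r) (+ k′)) ⟩
    ι (n !) * (C - (binom (+ r) (+ k′) + binom (+ r) (+ k)))
      ≡⟨ cong (λ x → ι (n !) * (C - x)) (binom-pascal (+ r) k′) ⟨
    ι (n !) * (C - binom (+ r ℤ.+ 1ℤ) (+ k))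
      ≡⟨ cong (λ x → ι (n !) * (C - binom x (+ k))) (+suc r) ⟩
    ι (n !) * (C - binom (+ suc r) (+ k)) ∎
    where
    eq′ : suc i ℕ.+ r ≡ n
    eq′ = trans (sym (ℕ.+-suc i r)) eq
    arrange : ∀ f c x y → f * (c - x) - f * y ≡ f * (c - (y + x))
    arrange = solve-∀ ℚ-ring

-- The potential function

module Potential (k′ y : ℕ) (k<n : suc k′ < suc (k′ ℕ.+ suc y)) where

  b : ℕ
  b = suc y
  open Closed k′ b
  open Ranks k

  N⁻ C⁻ : ℚ
  N⁻ = recip! n
  C⁻ = (1/ C) {{binom-nonZero (ℕ.<⇒≤ k<n)}}

  C⁻*C : C⁻ * C ≡ 1ℚ
  C⁻*C = ℚ.*-inverseˡ C {{binom-nonZero (ℕ.<⇒≤ k<n)}}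

  summand : ℕ → ℚ
  summand j = binom (+ n ℤ.- + suc j ℤ.- 1ℤ) (+ k ℤ.- 1ℤ) * recip (suc j)

  harmonic : ℕ → ℚ
  harmonic x = ∑ {x} (summand ∘ toℕ)

  n-i-1 : ∀ {i r} → i ℕ.+ suc r ≡ n → + n ℤ.- + i ℤ.- 1ℤ ≡ + r
  n-i-1 {i} {r} eq = trans (cong (λ x → + x ℤ.- + i ℤ.- 1ℤ) (sym eq)) (cancel (+ i) (+ r))
    where
    cancel : ∀ i r → i ℤ.+ (1ℤ ℤ.+ r) ℤ.- i ℤ.- 1ℤ ≡ r
    cancel = ℤ-ring.solve-∀

  harmonic-suc : ∀ {x r} → suc x ℕ.+ suc r ≡ n →
    harmonic (suc x) ≡ harmonic x + binom (+ r) (+ k′) * recip (suc x)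
  harmonic-suc {x} {r} eq = trans (∑-toℕ-suc x summand)
    (cong (λ z → harmonic x + binom z (+ k′) * recip (suc x)) (n-i-1 {suc x} {r} eq))

  -- The correction that makes value constant between thresholds; r + i = n − 1.
  F : (l r i : ℕ) → ℚ
  F 0      r i = 0ℚ
  F 1      r i = - d k<n 1 (i ∸ 1) - ι ((i ∸ 1) !) * S (suc r) i 1 * N⁻
  F (2+ m) r i = - (ι ((i ∸ 2+ m) !) * S (suc r) i (suc m) * N⁻ * recip (suc m))

  value : (l r i u : ℕ) → ℚ
  value l r i u = ι ((i ∸ l) !) * ι u * N⁻ + F l r i

  -- The change of the correction must absorb the successes due to a selection at the next
  -- candidate. For l = 1, dividing `S₁-scaled` by i n! C(n,k) leaves precisely the next summand of
  -- the sum in d_1. For l ≥ 2, `S-suc` at l - 1 produces σ_l with coefficient l - 1, which the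
  -- division by l - 1 cancels.
  F-suc : ∀ l {r i} → l ≤ i → suc i ℕ.+ suc r ≡ n →
    ι ((i ∸ l) !) * S (suc r) (suc i) l * N⁻ + F l (suc r) i ≡ F l r (suc i)
  F-suc 0 {r} {i} _ _ = vanish (ι (i !)) N⁻
    where
    vanish : ∀ f N → f * 0ℚ * N + 0ℚ ≡ 0ℚ
    vanish = solve-∀ ℚ-ring
  F-suc 1 {r} {suc x} _ eq = begin
    X * S′ * N⁻ + (- d k<n 1 x - X * S″ * N⁻)
      ≡⟨ cong (λ z → X * S′ * N⁻ + (- d k<n 1 x - z)) scaled ⟩
    X * S′ * N⁻ + (- (- (+ k / n) - 1ℚ * C⁻ * harmonic x) - ((1ℚ + I) * X * S′ * N⁻ - C⁻ * h * ρ))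
      ≡⟨ arrange X S′ N⁻ (+ k / n) C⁻ (harmonic x) I h ρ ⟩
    - (- (+ k / n) - 1ℚ * C⁻ * (harmonic x + h * ρ)) - I * X * S′ * N⁻
      ≡⟨ cong₂ (λ z w → - (- (+ k / n) - 1ℚ * C⁻ * z) - w * S′ * N⁻) (sym (harmonic-suc {x} {suc r} eq′)) (sym (ι-! x)) ⟩
    - d k<n 1 (suc x) - ι (suc x !) * S′ * N⁻ ∎
    where
    X = ι (x !)
    I = ι (suc x)
    ρ = recip (suc x)
    S′ = S (suc r) (suc (suc x)) 1
    S″ = S (suc (suc r)) (suc x) 1
    h = binom (+ suc r) (+ k′)
    eq′ : suc x ℕ.+ suc (suc r) ≡ n
    eq′ = trans (ℕ.+-suc (suc x) (suc r)) eq
    pull : ∀ x s n i ρ c c⁻ → (ρ * i) * (c⁻ * c) * (x * s * n) ≡ ρ * c⁻ * n * (i * x * s * c)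
    pull = solve-∀ ℚ-ring
    push : ∀ x s n i ρ c c⁻ f h →
      ρ * c⁻ * n * ((1ℚ + i) * (i * x) * s * c - f * h) ≡ (ρ * i) * (c⁻ * c) * ((1ℚ + i) * x * s * n) - (n * f) * (c⁻ * h * ρ)
    push = solve-∀ ℚ-ring
    scaled : X * S″ * N⁻ ≡ (1ℚ + I) * X * S′ * N⁻ - C⁻ * h * ρ
    scaled = begin
      X * S″ * N⁻                              ≡⟨ unit₂ (X * S″ * N⁻) ⟩
      (1ℚ * 1ℚ) * (X * S″ * N⁻)                ≡⟨ cong₂ (λ z w → z * w * (X * S″ * N⁻)) (recip-*-ι (suc x)) C⁻*C ⟨
      (ρ * I) * (C⁻ * C) * (X * S″ * N⁻)       ≡⟨ pull X S″ N⁻ I ρ C C⁻ ⟩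
      ρ * C⁻ * N⁻ * (I * X * S″ * C)           ≡⟨ cong (λ z → ρ * C⁻ * N⁻ * (z * S″ * C)) (ι-! x) ⟨
      ρ * C⁻ * N⁻ * (ι (suc x !) * S″ * C)     ≡⟨ cong (ρ * C⁻ * N⁻ *_) (S₁-scaled (suc r) {suc x} eq) ⟩
      ρ * C⁻ * N⁻ * (ι (suc (suc x) !) * S′ * C - ι (n !) * h)
        ≡⟨ cong (λ z → ρ * C⁻ * N⁻ * (z * S′ * C - ι (n !) * h))
             (trans (ι-! (suc x)) (cong₂ _*_ (ι-suc (suc x)) (ι-! x))) ⟩
      ρ * C⁻ * N⁻ * ((1ℚ + I) * (I * X) * S′ * C - ι (n !) * h)
        ≡⟨ push X S′ N⁻ I ρ C C⁻ (ι (n !)) h ⟩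
      (ρ * I) * (C⁻ * C) * ((1ℚ + I) * X * S′ * N⁻) - (N⁻ * ι (n !)) * (C⁻ * h * ρ)
        ≡⟨ cong₂ (λ z w → z * w * ((1ℚ + I) * X * S′ * N⁻) - (N⁻ * ι (n !)) * (C⁻ * h * ρ)) (recip-*-ι (suc x)) C⁻*C ⟩
      (1ℚ * 1ℚ) * ((1ℚ + I) * X * S′ * N⁻) - (N⁻ * ι (n !)) * (C⁻ * h * ρ)
        ≡⟨ cong₂ (λ z w → z - w * (C⁻ * h * ρ)) (sym (unit₂ ((1ℚ + I) * X * S′ * N⁻))) (recip!-*-ι n) ⟩
      (1ℚ + I) * X * S′ * N⁻ - 1ℚ * (C⁻ * h * ρ)
        ≡⟨ cong (λ z → (1ℚ + I) * X * S′ * N⁻ - z) (ℚ.*-identityˡ (C⁻ * h * ρ)) ⟩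
      (1ℚ + I) * X * S′ * N⁻ - C⁻ * h * ρ ∎
      where
      unit₂ : ∀ z → z ≡ (1ℚ * 1ℚ) * z
      unit₂ z = sym (ℚ.*-identityˡ z)
    arrange : ∀ x s n κ c H i h ρ →
      x * s * n + (- (- κ - 1ℚ * c * H) - ((1ℚ + i) * x * s * n - c * h * ρ)) ≡
      - (- κ - 1ℚ * c * (H + h * ρ)) - i * x * s * n
    arrange = solve-∀ ℚ-ring
  F-suc (2+ m) {r} {i} l≤i eq = begin
    f * S₂ * N⁻ + - (f * S (suc (suc r)) i (suc m) * N⁻ * ρ)
      ≡⟨ cong (λ z → f * S₂ * N⁻ + - (f * z * N⁻ * ρ)) (S-suc (suc r) (suc m) (ℕ.m≤n⇒m≤1+n (ℕ.<⇒≤ l≤i))) ⟩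
    f * S₂ * N⁻ + - (f * ((ι i - M) * S₁ + M * S₂) * N⁻ * ρ)
      ≡⟨ arrange f S₂ N⁻ (ι i - M) S₁ M ρ ⟩
    f * S₂ * N⁻ * (1ℚ - ρ * M) - ((ι i - M) * f) * S₁ * N⁻ * ρ
      ≡⟨ cong₂ (λ z w → f * S₂ * N⁻ * (1ℚ - z) - (w * f) * S₁ * N⁻ * ρ) (recip-*-ι (suc m)) (sym (ι-∸ (ℕ.<⇒≤ l≤i))) ⟩
    f * S₂ * N⁻ * (1ℚ - 1ℚ) - (ι (i ∸ suc m) * f) * S₁ * N⁻ * ρ
      ≡⟨ cong (λ z → f * S₂ * N⁻ * (1ℚ - 1ℚ) - z * S₁ * N⁻ * ρ) factorial ⟩
    f * S₂ * N⁻ * (1ℚ - 1ℚ) - ι ((i ∸ suc m) !) * S₁ * N⁻ * ρ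
      ≡⟨ vanish (f * S₂ * N⁻) (ι ((i ∸ suc m) !) * S₁ * N⁻ * ρ) ⟩
    - (ι ((i ∸ suc m) !) * S₁ * N⁻ * ρ) ∎
    where
    f = ι ((i ∸ 2+ m) !)
    M = ι (suc m)
    ρ = recip (suc m)
    S₁ = S (suc r) (suc i) (suc m)
    S₂ = S (suc r) (suc i) (2+ m)
    factorial : ι (i ∸ suc m) * f ≡ ι ((i ∸ suc m) !)
    factorial = subst (λ z → ι z * f ≡ ι (z !)) (sym (ℕ.+-∸-assoc 1 l≤i)) (sym (ι-! (i ∸ 2+ m)))
    arrange : ∀ f s₂ n e s₁ m ρ →
      f * s₂ * n + - (f * (e * s₁ + m * s₂) * n * ρ) ≡ f * s₂ * n * (1ℚ - ρ * m) - (e * f) * s₁ * n * ρ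
    arrange = solve-∀ ℚ-ring
    vanish : ∀ x y → x * (1ℚ - 1ℚ) - y ≡ - y
    vanish = solve-∀ ℚ-ring

  value-suc : ∀ l {r i} u′ → l ≤ i → suc i ℕ.+ suc r ≡ n →
    value l (suc r) i (topCompletions (suc r) (suc i) l ℕ.+ (suc i ∸ l) ℕ.* u′) ≡ value l r (suc i) u′
  value-suc l {r} {i} u′ l≤i eq = begin
    f * ι (T ℕ.+ e ℕ.* u′) * N⁻ + F l (suc r) i
      ≡⟨ cong (λ z → f * z * N⁻ + F l (suc r) i) (trans (ι-+ T (e ℕ.* u′)) (cong (λ x → ι T + x) (ι-* e u′))) ⟩
    f * (ι T + ι e * ι u′) * N⁻ + F l (suc r) i
      ≡⟨ arrange f (ι T) (ι e) (ι u′) N⁻ (F l (suc r) i) ⟩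
    ι e * f * ι u′ * N⁻ + (f * ι T * N⁻ + F l (suc r) i)
      ≡⟨ cong₂ (λ z w → z * ι u′ * N⁻ + w) factorial (F-suc l l≤i eq) ⟩
    ι (e !) * ι u′ * N⁻ + F l r (suc i) ∎
    where
    T = topCompletions (suc r) (suc i) l
    e = suc i ∸ l
    f = ι ((i ∸ l) !)
    factorial : ι e * f ≡ ι (e !)
    factorial = subst (λ z → ι z * f ≡ ι (z !)) (sym (ℕ.+-∸-assoc 1 l≤i)) (sym (ι-! (i ∸ l)))
    arrange : ∀ f t e u n F → f * (t + e * u) * n + F ≡ e * f * u * n + (f * t * n + F)
    arrange = solve-∀ ℚ-ring

  -- C(n-i, k) is split by Pascal's rule because its halves appear in different places of d_0: one
  -- as a separate term, the other as the last summand of the sum.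
  S₁-probability : ∀ r {i} → i ℕ.+ suc r ≡ n →
    ι (i !) * S (suc r) i 1 * N⁻ ≡ 1ℚ - (binom (+ r) (+ k′) + binom (+ r) (+ k)) * C⁻
  S₁-probability r {i} eq = begin
    A * N⁻                                  ≡⟨ ℚ.*-identityˡ (A * N⁻) ⟨
    1ℚ * (A * N⁻)                           ≡⟨ cong (_* (A * N⁻)) C⁻*C ⟨
    C⁻ * C * (A * N⁻)                       ≡⟨ pull C⁻ C A N⁻ ⟩
    C⁻ * N⁻ * (A * C)                       ≡⟨ cong (C⁻ * N⁻ *_) (S₁-closed (suc r) eq) ⟩
    C⁻ * N⁻ * (ι (n !) * (C - binom (+ suc r) (+ k)))
      ≡⟨ cong (λ z → C⁻ * N⁻ * (ι (n !) * (C - z))) (trans (cong (λ z → binom z (+ k)) (sym (+suc r))) (binom-pascal (+ r) k′)) ⟩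
    C⁻ * N⁻ * (ι (n !) * (C - B))           ≡⟨ push C⁻ N⁻ (ι (n !)) C B ⟩
    N⁻ * ι (n !) * (C⁻ * C - B * C⁻)        ≡⟨ cong₂ (λ z w → z * (w - B * C⁻)) (recip!-*-ι n) C⁻*C ⟩
    1ℚ * (1ℚ - B * C⁻)                      ≡⟨ ℚ.*-identityˡ (1ℚ - B * C⁻) ⟩
    1ℚ - B * C⁻                             ∎
    where
    A = ι (i !) * S (suc r) i 1
    B = binom (+ r) (+ k′) + binom (+ r) (+ k)
    pull : ∀ c⁻ c a n → c⁻ * c * (a * n) ≡ c⁻ * n * (a * c)
    pull = solve-∀ ℚ-ring
    push : ∀ c⁻ n f c b → c⁻ * n * (f * (c - b)) ≡ n * f * (c⁻ * c - b * c⁻)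
    push = solve-∀ ℚ-ring

  -- This relation determines `d`. For l ≥ 2 it says that d_l(i-l) is (i-l)!/n! times
  -- σ_{l-1}(i)/(l-1) - σ_l(i)/l; over the common denominator l(l-1) the numerator is the gap at m =
  -- l - 1.
  F-switch : ∀ l {r i} → l < k → l < i → i ℕ.+ suc r ≡ n →
    F l r i ≡ ι (i ∸ l) * F (suc l) r i - d k<n l (i ∸ l)
  F-switch 0 {r} {suc x} _ _ eq = begin
    0ℚ
      -- The last two summands are zero, by `S₁-probability` and because ρ is the inverse of I.
      -- Adding them makes the equation an identity of polynomials.
      ≡⟨ arrange X I s N⁻ (ι k * recip n) C⁻ H B B′ ρ (1ℚ - (B + B′) * C⁻) ⟩
    I * (- (- (ι k * recip n) - 1ℚ * C⁻ * H) - X * s * N⁻)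
      - (- 1ℚ + I * (ι k * recip n) + B′ * C⁻ + (I * C⁻) * (H + B * ρ))
      + (I * X * s * N⁻ - (1ℚ - (B + B′) * C⁻)) + (ρ * I - 1ℚ) * (B * C⁻)
      ≡⟨ cong₂ (λ z w → D + (z - (1ℚ - (B + B′) * C⁻)) + (w - 1ℚ) * (B * C⁻))
           (trans (cong (λ z → z * s * N⁻) (sym (ι-! x))) (S₁-probability r {suc x} eq)) (recip-*-ι (suc x)) ⟩
    D + ((1ℚ - (B + B′) * C⁻) - (1ℚ - (B + B′) * C⁻)) + (1ℚ - 1ℚ) * (B * C⁻)
      ≡⟨ drop D (1ℚ - (B + B′) * C⁻) (B * C⁻) ⟩
    I * (- (- (ι k * recip n) - 1ℚ * C⁻ * H) - X * s * N⁻)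
      - (- 1ℚ + I * (ι k * recip n) + B′ * C⁻ + (I * C⁻) * (H + B * ρ))
      ≡⟨ cong₂ (λ z w → I * (- (- z - 1ℚ * C⁻ * H) - X * s * N⁻) - (- 1ℚ + w + B′ * C⁻ + (I * C⁻) * (H + B * ρ)))
           (sym (/≡*recip (+ k) n)) kx/n ⟩
    I * (- d k<n 1 x - X * s * N⁻)
      - (- 1ℚ + (+ (k ℕ.* suc x) / n) + B′ * C⁻ + (I * C⁻) * (H + B * ρ))
      ≡⟨ cong₂ (λ z w → I * (- d k<n 1 x - X * s * N⁻) - (- 1ℚ + (+ (k ℕ.* suc x) / n) + z * C⁻ + (I * C⁻) * w))
           (cong (λ z → binom z (+ k)) (sym (n-i-1 {suc x} {r} eq))) (sym (harmonic-suc {x} {r} eq)) ⟩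
    I * (- d k<n 1 x - X * s * N⁻) - d k<n 0 (suc x) ∎
    where
    X = ι (x !)
    I = ι (suc x)
    ρ = recip (suc x)
    s = S (suc r) (suc x) 1
    H = harmonic x
    B = binom (+ r) (+ k′)
    B′ = binom (+ r) (+ k)
    D = I * (- (- (ι k * recip n) - 1ℚ * C⁻ * H) - X * s * N⁻)
      - (- 1ℚ + I * (ι k * recip n) + B′ * C⁻ + (I * C⁻) * (H + B * ρ))
    kx/n : I * (ι k * recip n) ≡ + (k ℕ.* suc x) / n
    kx/n = begin
      I * (ι k * recip n)        ≡⟨ swap I (ι k) (recip n) ⟩
      ι k * I * recip n          ≡⟨ cong (_* recip n) (ι-* k (suc x)) ⟨
      ι (k ℕ.* suc x) * recip n  ≡⟨ /≡*recip (+ (k ℕ.* suc x)) n ⟨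
      + (k ℕ.* suc x) / n        ∎
      where
      swap : ∀ a b c → a * (b * c) ≡ b * a * c
      swap = solve-∀ ℚ-ring
    arrange : ∀ x i s n κ c H B B′ ρ P →
      0ℚ ≡ i * (- (- κ - 1ℚ * c * H) - x * s * n)
           - (- 1ℚ + i * κ + B′ * c + (i * c) * (H + B * ρ))
           + (i * x * s * n - (1ℚ - (B + B′) * c)) + (ρ * i - 1ℚ) * (B * c)
    arrange = solve-∀ ℚ-ring
    drop : ∀ D P z → D + (P - P) + (1ℚ - 1ℚ) * z ≡ D
    drop = solve-∀ ℚ-ring
  F-switch 1 {r} {2+ x} _ (s≤s (s≤s _)) eq = begin
    - d k<n 1 (suc x) - ι (suc x !) * s * N⁻
      ≡⟨ cong (λ z → - d k<n 1 (suc x) - z * s * N⁻) (ι-! x) ⟩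
    - d k<n 1 (suc x) - ι (suc x) * ι (x !) * s * N⁻
      -- For l + 1 = 2 the divisor in the correction is 1, so `recip 1` computes to `1ℚ`.
      ≡⟨ arrange (d k<n 1 (suc x)) (ι (suc x)) (ι (x !)) s N⁻ ⟩
    ι (suc x) * - (ι (x !) * s * N⁻ * 1ℚ) - d k<n 1 (suc x) ∎
    where
    s = S (suc r) (2+ x) 1
    arrange : ∀ d i x s n → - d - i * x * s * n ≡ i * - (x * s * n * 1ℚ) - d
    arrange = solve-∀ ℚ-ring
  F-switch (2+ m) {r} {i} _ l<i eq = begin
    - (ι (x !) * s₁ * N⁻ * ρ₁)
      ≡⟨ split (ι (x !) * s₁ * N⁻ * ρ₁) (ι x) (f * s₂ * N⁻ * ρ₂) ⟩
    ι x * - (f * s₂ * N⁻ * ρ₂) - (ι (x !) * s₁ * N⁻ * ρ₁ - ι x * (f * s₂ * N⁻ * ρ₂))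
      ≡⟨ cong (λ z → ι x * - (f * s₂ * N⁻ * ρ₂) - z) (sym d≡) ⟩
    ι x * - (f * s₂ * N⁻ * ρ₂) - d k<n (2+ m) x ∎
    where
    x = i ∸ 2+ m
    f = ι ((i ∸ suc (2+ m)) !)
    s₁ = S (suc r) i (suc m)
    s₂ = S (suc r) i (2+ m)
    ρ₁ = recip (suc m)
    ρ₂ = recip (2+ m)
    X = ι (x !)
    T = tail (suc m) i
    l≤i : 2+ m ≤ i
    l≤i = ℕ.<⇒≤ l<i
    split : ∀ a e b → - a ≡ e * - b - (a - e * b)
    split = solve-∀ ℚ-ring
    factorial : X ≡ ι x * f
    factorial = subst (λ z → ι (z !) ≡ ι z * f) (sym (ℕ.+-∸-assoc 1 l<i)) (ι-! (i ∸ suc (2+ m)))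
    d≡ : d k<n (2+ m) x ≡ X * s₁ * N⁻ * ρ₁ - ι x * (f * s₂ * N⁻ * ρ₂)
    d≡ = begin
      d k<n (2+ m) x
        ≡⟨ cong₂ _*_ coefficient tail≡ ⟩
      ι k * X * ι (suc r !) * (ρ₂ * ρ₁ * N⁻) * T
        ≡⟨ pull (ι k) X (ι (suc r !)) ρ₂ ρ₁ N⁻ T ⟩
      X * N⁻ * ρ₂ * ρ₁ * (ι k * ι (suc r !) * T)
        ≡⟨ cong (X * N⁻ * ρ₂ * ρ₁ *_) (topCompletions-gap (suc r) (suc m) eq (ℕ.<⇒≤ l≤i)) ⟨
      X * N⁻ * ρ₂ * ρ₁ * (ι (2+ m) * s₁ - ι (suc m) * s₂)
        ≡⟨ push X N⁻ ρ₂ ρ₁ (ι (2+ m)) s₁ (ι (suc m)) s₂ ⟩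
      ρ₂ * ι (2+ m) * (X * s₁ * N⁻ * ρ₁) - ρ₁ * ι (suc m) * (X * s₂ * N⁻ * ρ₂)
        ≡⟨ cong₂ (λ z w → z * (X * s₁ * N⁻ * ρ₁) - w * (X * s₂ * N⁻ * ρ₂)) (recip-*-ι (2+ m)) (recip-*-ι (suc m)) ⟩
      1ℚ * (X * s₁ * N⁻ * ρ₁) - 1ℚ * (X * s₂ * N⁻ * ρ₂)
        ≡⟨ cong (λ z → 1ℚ * (X * s₁ * N⁻ * ρ₁) - 1ℚ * (z * s₂ * N⁻ * ρ₂)) factorial ⟩
      1ℚ * (X * s₁ * N⁻ * ρ₁) - 1ℚ * (ι x * f * s₂ * N⁻ * ρ₂)
        ≡⟨ tidy (X * s₁ * N⁻ * ρ₁) (ι x) f s₂ N⁻ ρ₂ ⟩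
      X * s₁ * N⁻ * ρ₁ - ι x * (f * s₂ * N⁻ * ρ₂) ∎
      where
      pull : ∀ k x r ρ₂ ρ₁ n t → k * x * r * (ρ₂ * ρ₁ * n) * t ≡ x * n * ρ₂ * ρ₁ * (k * r * t)
      pull = solve-∀ ℚ-ring
      push : ∀ x n ρ₂ ρ₁ l s₁ m s₂ →
        x * n * ρ₂ * ρ₁ * (l * s₁ - m * s₂) ≡ ρ₂ * l * (x * s₁ * n * ρ₁) - ρ₁ * m * (x * s₂ * n * ρ₂)
      push = solve-∀ ℚ-ring
      tidy : ∀ a x f s n ρ → 1ℚ * a - 1ℚ * (x * f * s * n * ρ) ≡ a - x * (f * s * n * ρ)
      tidy = solve-∀ ℚ-ring
      instance
        _ = n ℕ.!≢0
        _ = ℕ.m*n≢0 (2+ m ℕ.* suc m) (n !)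
      r≡ : n ∸ 2+ m ∸ x ≡ suc r
      r≡ = begin
        n ∸ 2+ m ∸ x       ≡⟨ ℕ.∸-+-assoc n (2+ m) x ⟩
        n ∸ (2+ m ℕ.+ x)   ≡⟨ cong₂ _∸_ (sym eq) (ℕ.m+[n∸m]≡n l≤i) ⟩
        i ℕ.+ suc r ∸ i    ≡⟨ ℕ.m+n∸m≡n i (suc r) ⟩
        suc r              ∎
      coefficient : + (k ℕ.* x ! ℕ.* (n ∸ 2+ m ∸ x) !) / (2+ m ℕ.* suc m ℕ.* n !) ≡
                    ι k * X * ι (suc r !) * (ρ₂ * ρ₁ * N⁻)
      coefficient = begin
        + (k ℕ.* x ! ℕ.* (n ∸ 2+ m ∸ x) !) / (2+ m ℕ.* suc m ℕ.* n !)
          ≡⟨ cong (λ z → + (k ℕ.* x ! ℕ.* z !) / (2+ m ℕ.* suc m ℕ.* n !)) r≡ ⟩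
        + (k ℕ.* x ! ℕ.* suc r !) / (2+ m ℕ.* suc m ℕ.* n !)
          ≡⟨ /≡*recip (+ (k ℕ.* x ! ℕ.* suc r !)) (2+ m ℕ.* suc m ℕ.* n !) ⟩
        ι (k ℕ.* x ! ℕ.* suc r !) * recip (2+ m ℕ.* suc m ℕ.* n !)
          ≡⟨ cong₂ _*_ (trans (ι-* (k ℕ.* x !) (suc r !)) (cong (_* ι (suc r !)) (ι-* k (x !))))
               (trans (recip-* (2+ m ℕ.* suc m) (n !)) (cong (_* N⁻) (recip-* (2+ m) (suc m)))) ⟩
        ι k * X * ι (suc r !) * (ρ₂ * ρ₁ * N⁻) ∎
      n-k : + n ℤ.- + k ≡ + b
      n-k = cancel (+ k′) (+ b)
        where
        cancel : ∀ k b → (1ℤ ℤ.+ (k ℤ.+ b)) ℤ.- (1ℤ ℤ.+ k) ≡ b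
        cancel = ℤ-ring.solve-∀
      tail≡ : ∑ {suc m} (λ j → binom (+ k ℤ.- 1ℤ) (+ toℕ j) * binom (+ n ℤ.- + k) (+ x ℤ.+ + 2+ m ℤ.- + toℕ j ℤ.- 1ℤ)) ≡ T
      tail≡ = ∑-cong {suc m} λ j → cong₂ (λ z w → binom (+ k′) (+ toℕ j) * binom z (+ w ℤ.- + toℕ j ℤ.- 1ℤ)) n-k (ℕ.m∸n+n≡m l≤i)

  -- The factor i - l is what (i-l)! has over (i-l-1)!. At i = s_{l+1} it equals t_{l+1}.
  value-switch : ∀ l {r i} u → l < k → l < i → i ℕ.+ suc r ≡ n →
    value l r i u ≡ ι (i ∸ l) * value (suc l) r i u - d k<n l (i ∸ l)
  value-switch l {r} {i} u l<k l<i eq = begin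
    ι ((i ∸ l) !) * ι u * N⁻ + F l r i
      ≡⟨ cong₂ (λ z w → z * ι u * N⁻ + w) factorial (F-switch l l<k l<i eq) ⟩
    ι (i ∸ l) * f * ι u * N⁻ + (ι (i ∸ l) * F (suc l) r i - d k<n l (i ∸ l))
      ≡⟨ arrange (ι (i ∸ l)) f (ι u) N⁻ (F (suc l) r i) (d k<n l (i ∸ l)) ⟩
    ι (i ∸ l) * (f * ι u * N⁻ + F (suc l) r i) - d k<n l (i ∸ l) ∎
    where
    f = ι ((i ∸ suc l) !)
    factorial : ι ((i ∸ l) !) ≡ ι (i ∸ l) * f
    factorial = subst (λ z → ι (z !) ≡ ι z * f) (sym (ℕ.+-∸-assoc 1 l<i)) (ι-! (i ∸ suc l))
    arrange : ∀ e f u n F d → e * f * u * n + (e * F - d) ≡ e * (f * u * n + F) - d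
    arrange = solve-∀ ℚ-ring

-- The potential at i = n - 1

value-end-1 : ∀ y (k<n : 1 < suc (suc y)) → let open Potential 0 y k<n in
  value 1 0 (suc y) 1 ≡ - δ k<n
value-end-1 y k<n = begin
  X * 1ℚ * N⁻ + (- (- (+ 1 / n) - 1ℚ * C⁻ * harmonic y) - X * S 1 (suc y) 1 * N⁻)
    ≡⟨ cong (λ z → X * 1ℚ * N⁻ + (- (- R - 1ℚ * C⁻ * harmonic y) - X * z * N⁻)) S≡ ⟩
  X * 1ℚ * N⁻ + (- (- R - 1ℚ * C⁻ * harmonic y) - X * I * N⁻)
    ≡⟨ cong₂ (λ z w → X * 1ℚ * N⁻ + (- (- R - 1ℚ * z * w) - X * I * N⁻)) C⁻≡ (∑-cong {y} (λ j → ℚ.*-identityˡ (recip (suc (toℕ j))))) ⟩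
  X * 1ℚ * N⁻ + (- (- R - 1ℚ * R * H) - X * I * N⁻)
    ≡⟨ arrange X I N⁻ R H ⟩
  (1ℚ - I) * (X * N⁻) + (R + R * H)
    ≡⟨ cong (λ z → (1ℚ - I) * z + (R + R * H)) XN⁻≡ ⟩
  -- `H` stops at 1/(n-2), whereas δ sums up to 1/(n-1). The missing term comes from (n-2)!/n! =
  -- 1/(n(n-1)).
  (1ℚ - I) * (R * ρ) + (R + R * H)
    ≡⟨ arrange′ I R ρ H ⟩
  - - (R * (H + ρ)) + R * (1ℚ - ρ * I)
    ≡⟨ cong₂ (λ z w → - - (R * z) + R * (1ℚ - w)) (sym (∑-toℕ-suc y (λ j → recip (suc j)))) (recip-*-ι (suc y)) ⟩
  - δ k<n + R * (1ℚ - 1ℚ)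
    ≡⟨ drop (- δ k<n) R ⟩
  - δ k<n ∎
  where
  open Potential 0 y k<n
  open Closed 0 b
  open Ranks 1
  X = ι (y !)
  I = ι (suc y)
  R = recip n
  ρ = recip (suc y)
  H = ∑ {y} (λ j → recip (suc (toℕ j)))
  S≡ : S 1 (suc y) 1 ≡ I
  S≡ = begin
    S 1 (suc y) 1                                ≡⟨ S-suc 0 {suc y} 1 (s≤s z≤n) ⟩
    (I - 1ℚ) * S 0 n 1 + 1ℚ * S 0 n 2
      ≡⟨ cong₂ (λ z w → (I - 1ℚ) * ι z + 1ℚ * ι w) (topCompletions-end n 1) (topCompletions-end n 2) ⟩
    (I - 1ℚ) * 1ℚ + 1ℚ * 1ℚ                      ≡⟨ simplify I ⟩
    I                                            ∎
    where
    simplify : ∀ i → (i - 1ℚ) * 1ℚ + 1ℚ * 1ℚ ≡ i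
    simplify = solve-∀ ℚ-ring
  C≡ : C ≡ ι n
  C≡ = begin
    C                 ≡⟨ ℚ.*-identityˡ C ⟨
    1ℚ * C            ≡⟨ binom-suc (+ n) 0 ⟩
    (ι n - 0ℚ) * 1ℚ   ≡⟨ simplify (ι n) ⟩
    ι n               ∎
    where
    simplify : ∀ i → (i - 0ℚ) * 1ℚ ≡ i
    simplify = solve-∀ ℚ-ring
  C⁻≡ : C⁻ ≡ R
  C⁻≡ = *-cancelʳ-ι n (trans (cong (C⁻ *_) (sym C≡)) (trans C⁻*C (sym (recip-*-ι n))))
  XN⁻≡ : X * N⁻ ≡ R * ρ
  XN⁻≡ = begin
    X * N⁻                             ≡⟨ ℚ.*-identityˡ (X * N⁻) ⟨
    1ℚ * 1ℚ * (X * N⁻)                 ≡⟨ cong₂ (λ z w → z * w * (X * N⁻)) (recip-*-ι n) (recip-*-ι (suc y)) ⟨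
    R * ι n * (ρ * I) * (X * N⁻)       ≡⟨ swap R (ι n) ρ I X N⁻ ⟩
    N⁻ * (ι n * (I * X)) * (R * ρ)     ≡⟨ cong (λ z → N⁻ * z * (R * ρ)) (trans (ι-! (suc y)) (cong (ι n *_) (ι-! y))) ⟨
    N⁻ * ι (n !) * (R * ρ)             ≡⟨ cong (_* (R * ρ)) (recip!-*-ι n) ⟩
    1ℚ * (R * ρ)                       ≡⟨ ℚ.*-identityˡ (R * ρ) ⟩
    R * ρ                              ∎
    where
    swap : ∀ R n ρ i x N → R * n * (ρ * i) * (x * N) ≡ N * (n * (i * x)) * (R * ρ)
    swap = solve-∀ ℚ-ring
  arrange : ∀ x i n r h → x * 1ℚ * n + (- (- r - 1ℚ * r * h) - x * i * n) ≡ (1ℚ - i) * (x * n) + (r + r * h)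
  arrange = solve-∀ ℚ-ring
  arrange′ : ∀ i r ρ h → (1ℚ - i) * (r * ρ) + (r + r * h) ≡ - - (r * (h + ρ)) + r * (1ℚ - ρ * i)
  arrange′ = solve-∀ ℚ-ring
  drop : ∀ z r → z + r * (1ℚ - 1ℚ) ≡ z
  drop = solve-∀ ℚ-ring

-- One newcomer cannot push any of the k - 1 best of n - 1 candidates out of the k best, so
-- σ_{k-1}(n-1) = (k-1) n. The bracket of the potential is then k - n, which completes (n-1-k)! to
-- -(n-k)!.
value-end-2+ : ∀ q y (k<n : 2+ q < suc (suc q ℕ.+ suc y)) → let open Potential (suc q) y k<n in
  value (2+ q) 0 (suc q ℕ.+ suc y) (2+ q) ≡ - δ k<n
value-end-2+ q y k<n = begin
  ι ((m ∸ 2+ q) !) * K * N⁻ + - (ι ((m ∸ 2+ q) !) * S 1 m (suc q) * N⁻ * ρ)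
    ≡⟨ cong₂ (λ z w → ι (z !) * K * N⁻ + - (ι (z !) * w * N⁻ * ρ)) m∸k S≡ ⟩
  X * K * N⁻ + - (X * (M * (I + K)) * N⁻ * ρ)
    ≡⟨ arrange X K N⁻ M I ρ ⟩
  X * N⁻ * (K - ρ * M * (I + K))
    ≡⟨ cong (λ z → X * N⁻ * (K - z * (I + K))) (recip-*-ι (suc q)) ⟩
  X * N⁻ * (K - 1ℚ * (I + K))
    ≡⟨ arrange′ X N⁻ K I ⟩
  - (I * X * N⁻)
    ≡⟨ cong (λ z → - (z * N⁻)) (ι-! y) ⟨
  - (ι (suc y !) * N⁻)
    ≡⟨ cong -_ (/!≡*recip! (+ (suc y !)) n) ⟨
  - (+ (suc y !) /! n)
    ≡⟨ cong (λ z → - (+ (z !) /! n)) (ℕ.m+n∸m≡n q (suc y)) ⟨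
  - δ k<n ∎
  where
  open Potential (suc q) y k<n
  open Closed (suc q) b
  open Ranks (2+ q)
  m : ℕ
  m = suc q ℕ.+ suc y
  X = ι (y !)
  I = ι (suc y)
  K = ι (2+ q)
  M = ι (suc q)
  ρ = recip (suc q)
  m∸k : m ∸ 2+ q ≡ y
  m∸k = trans (cong (_∸ suc q) (ℕ.+-suc q y)) (ℕ.m+n∸m≡n q y)
  S≡ : S 1 m (suc q) ≡ M * (I + K)
  S≡ = begin
    S 1 m (suc q)
      ≡⟨ S-suc 0 {m} (suc q) (s≤s (ℕ.<⇒≤ (ℕ.m≤m+n (suc q) (suc y)))) ⟩
    (ι m - M) * S 0 n (suc q) + M * S 0 n (2+ q)
      ≡⟨ cong₂ (λ z w → (ι m - M) * ι z + M * ι w)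
           (trans (topCompletions-end n (suc q)) (ℕ.m≤n⇒m⊓n≡m (ℕ.n≤1+n (suc q))))
           (trans (topCompletions-end n (2+ q)) (ℕ.⊓-idem (2+ q))) ⟩
    (ι m - M) * M + M * K
      ≡⟨ cong (λ z → (z - M) * M + M * K) (ι-+ (suc q) (suc y)) ⟩
    (M + I - M) * M + M * K
      ≡⟨ simplify M I K ⟩
    M * (I + K) ∎
    where
    simplify : ∀ m i k → (m + i - m) * m + m * k ≡ m * (i + k)
    simplify = solve-∀ ℚ-ring
  arrange : ∀ x k n m i ρ → x * k * n + - (x * (m * (i + k)) * n * ρ) ≡ x * n * (k - ρ * m * (i + k))
  arrange = solve-∀ ℚ-ring
  arrange′ : ∀ x n k i → x * n * (k - 1ℚ * (i + k)) ≡ - (i * x * n)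
  arrange′ = solve-∀ ℚ-ring

value-end : ∀ k′ y (k<n : suc k′ < suc (k′ ℕ.+ suc y)) → let open Potential k′ y k<n in
  value (suc k′) 0 (k′ ℕ.+ suc y) (suc k′) ≡ - δ k<n
value-end zero    = value-end-1
value-end (suc q) = value-end-2+ q

-- The thresholds

-- A Horner scheme: peeling off the first step shifts all three families, and its factor is
-- distributed into every later product.
unroll : ∀ k (t : Fin k → ℕ) (d : Fin k → ℚ) (e : Fin (suc k) → ℚ) {w} →
  (∀ i → e (inject₁ i) ≡ ι (t i) * e (suc i) - d i) → e (fromℕ k) ≡ - w →
  e zero ≡ - ∑ (λ i → ι (∏ (λ (j : Fin (toℕ i)) → t (inject {i = i} j))) * d i) - ι (∏ t) * w
unroll zero    t d e {w} step end = trans end (tidy w)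
  where
  tidy : ∀ w → - w ≡ - 0ℚ - 1ℚ * w
  tidy = solve-∀ ℚ-ring
unroll (suc k) t d e {w} step end = begin
  e zero
    ≡⟨ step zero ⟩
  t₀ * e (suc zero) - d zero
    ≡⟨ cong (λ z → t₀ * z - d zero) (unroll k (t ∘ suc) (d ∘ suc) (e ∘ suc) (step ∘ suc) end) ⟩
  t₀ * (- ∑ f - ι (∏ (t ∘ suc)) * w) - d zero
    ≡⟨ arrange t₀ (∑ f) (ι (∏ (t ∘ suc))) w (d zero) ⟩
  - (1ℚ * d zero + t₀ * ∑ f) - t₀ * ι (∏ (t ∘ suc)) * w
    ≡⟨ cong₂ (λ y z → - (1ℚ * d zero + y) - z * w)
         (trans (*-distribˡ-∑ {k} t₀ f) (∑-cong {k} λ i →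
           trans (sym (ℚ.*-assoc t₀ _ (d (suc i)))) (cong (_* d (suc i)) (sym (ι-* (t zero) _)))))
         (sym (ι-* (t zero) (∏ (t ∘ suc)))) ⟩
  - ∑ (λ i → ι (∏ (λ (j : Fin (toℕ i)) → t (inject {i = i} j))) * d i) - ι (∏ t) * w ∎
  where
  t₀ = ι (t zero)
  f : Fin k → ℚ
  f i = ι (∏ (λ (j : Fin (toℕ i)) → t (suc (inject {i = i} j)))) * d (suc i)
  arrange : ∀ t S P w d → t * (- S - P * w) - d ≡ - (1ℚ * d + t * S) - t * P * w
  arrange = solve-∀ ℚ-ring

lookup-∷ʳ-inject₁ : ∀ {A : Set} {k} (xs : Vec A k) x i → lookup (xs ∷ʳ x) (inject₁ i) ≡ lookup xs i
lookup-∷ʳ-inject₁ (_ ∷ xs) x zero    = refl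
lookup-∷ʳ-inject₁ (_ ∷ xs) x (suc i) = lookup-∷ʳ-inject₁ xs x i

lookup-∷ʳ-fromℕ : ∀ {A : Set} {k} (xs : Vec A k) x → lookup (xs ∷ʳ x) (fromℕ k) ≡ x
lookup-∷ʳ-fromℕ []       x = refl
lookup-∷ʳ-fromℕ (_ ∷ xs) x = lookup-∷ʳ-fromℕ xs x

-- The condition of Accepts, as a function of the zero-based position and the
-- relative rank only.
Acceptance : ∀ {k} → ℕ → Vec ℕ k → ℕ → ℕ → Set
Acceptance {k} n s i r = ∃ λ (l : Fin k) →
  (lookup s l < suc i × suc i ≤ lookup (s ∷ʳ (n ∸ 1)) (suc l)) × r ≤ suc (toℕ l)

acceptance? : ∀ {k} n (s : Vec ℕ k) → B.Decidable (Acceptance n s)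
acceptance? n s i r = Fin.any? λ l →
  ((lookup s l ℕ.<? suc i) ×-dec (suc i ℕ.≤? lookup (s ∷ʳ (n ∸ 1)) (suc l))) ×-dec (r ℕ.≤? suc (toℕ l))

-- Passes from the `NonZero` instance derived from k < n to an arbitrary one; the argument is
-- irrelevant, so both sides agree by computation.
successProbability≡wins : ∀ {n k} .{{_ : NonZero n}} (k<n : k < n) (s : Vec ℕ k) →
  successProbability k<n s ≡ (+ length (filter (success? {n} s) (orderings n))) /! n
successProbability≡wins k<n s = refl

-- `Accepts s π p` unfolds to `Acceptance` at `toℕ p` and `relativeRank π p`, so the policy is
-- literally an instance of `Play`.
wins≡successes : ∀ {m k} (s : Vec ℕ k) →
  length (filter (success? {suc m} s) (orderings (suc m))) ≡ Play.successes (acceptance? (suc m) s) k m 0 nothing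
wins≡successes {m} {k} s = Play.count-successes (acceptance? (suc m) s) k m

successProbability≡successes : ∀ {m k} (k<n : k < suc m) (s : Vec ℕ k) →
  successProbability k<n s ≡ ι (Play.successes (acceptance? (suc m) s) k m 0 nothing) * recip! (suc m)
successProbability≡successes {m} {k} k<n s = begin
  successProbability k<n s       ≡⟨ successProbability≡wins k<n s ⟩
  (+ wins) /! suc m              ≡⟨ /!≡*recip! (+ wins) (suc m) ⟩
  ι wins * recip! (suc m)        ≡⟨ cong (λ x → ι x * recip! (suc m)) (wins≡successes {m} s) ⟩
  ι (Play.successes (acceptance? (suc m) s) k m 0 nothing) * recip! (suc m) ∎
  where wins = length (filter (success? {suc m} s) (orderings (suc m)))

-- The stretches between consecutive thresholds

module Policy (k′ y : ℕ) (k<n : suc k′ < suc (k′ ℕ.+ suc y)) (s : Vec ℕ (suc k′))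
  (s-mono : ∀ i j → i Fin.≤ j → lookup s i ≤ lookup s j)
  (s-bounds : ∀ i → suc (toℕ i) ≤ lookup s i × lookup s i < suc (k′ ℕ.+ suc y)) where

  open Potential k′ y k<n
  open Closed k′ b

  m : ℕ
  m = k′ ℕ.+ suc y

  A : ℕ → ℕ → Set
  A = Acceptance n s

  A? : B.Decidable A
  A? = acceptance? n s

  open Play A?
  open Values A? k
  open Ranks k

  unselected : ℕ → ℕ → ℕ
  unselected r i = successes k r i nothing

  -- With s_0 = 0 and s_{k+1} = n - 1, stretch l consists of the i with s_l ≤ i < s_{l+1}. Here i is
  -- a zero-based position, so this is condition (i) of the policy for candidate i + 1; stretch 0
  -- accepts nobody.
  start finish : Fin (suc k) → ℕ
  start  l = lookup (0 ∷ s) l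
  finish l = lookup (s ∷ʳ m) l

  toℕ≤start : ∀ l → toℕ l ≤ start l
  toℕ≤start zero    = z≤n
  toℕ≤start (suc i) = proj₁ (s-bounds i)

  s≤m : ∀ i → lookup s i ≤ m
  s≤m i = s≤s⁻¹ (proj₂ (s-bounds i))

  finish≤m : ∀ l → finish l ≤ m
  finish≤m l with view l
  ... | ‵fromℕ     = ℕ.≤-reflexive (lookup-∷ʳ-fromℕ s m)
  ... | ‵inject₁ i = subst (_≤ m) (sym (lookup-∷ʳ-inject₁ s m i)) (s≤m i)

  start≤finish : ∀ l → start l ≤ finish l
  start≤finish zero = z≤n
  start≤finish (suc i) with view i
  ... | ‵fromℕ     = subst (lookup s i ≤_) (sym (lookup-∷ʳ-fromℕ s m)) (s≤m i)
  ... | ‵inject₁ j = subst (lookup s i ≤_) (sym (lookup-∷ʳ-inject₁ s m (suc j)))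
                       (s-mono (inject₁ j) (suc j) (ℕ.≤-trans (ℕ.≤-reflexive (Fin.toℕ-inject₁ j)) (ℕ.n≤1+n _)))

  finish≤s : ∀ l i → toℕ l ≤ toℕ i → finish l ≤ lookup s i
  finish≤s l i l≤i with view l
  ... | ‵fromℕ     = contradiction (Fin.toℕ<n i) (ℕ.≤⇒≯ (subst (_≤ toℕ i) (Fin.toℕ-fromℕ k) l≤i))
  ... | ‵inject₁ j = subst (_≤ lookup s i) (sym (lookup-∷ʳ-inject₁ s m j))
                       (s-mono j i (subst (_≤ toℕ i) (Fin.toℕ-inject₁ j) l≤i))

  accept : ∀ l {i} → start l ≤ i → i < finish l → ∀ j → j < toℕ l → A i (suc j)
  accept (suc l) s≤i i<f j j<l = l , (s≤s s≤i , i<f) , j<l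

  -- A witness that tolerates relative rank j + 1 belongs to a later stretch, and by monotonicity
  -- that stretch has not begun at i.
  reject : ∀ l {i} → i < finish l → ∀ j → toℕ l ≤ j → ¬ A i (suc j)
  reject l i<f j l≤j (l′ , (s<i , _) , j≤l′) =
    ℕ.<⇒≱ i<f (ℕ.≤-trans (finish≤s l l′ (ℕ.≤-trans l≤j (s≤s⁻¹ j≤l′))) (s≤s⁻¹ s<i))

  worth : (l r i : ℕ) → ℚ
  worth l r i = value l r i (unselected r i)

  -- `g` counts the steps to the end of the stretch and `r` those from there to n - 1. Equal
  -- thresholds give empty stretches, which fall under g = 0.
  worth-constant : ∀ l g {r i} → start l ≤ i → g ℕ.+ i ≡ finish l → g ℕ.+ r ℕ.+ i ≡ m →
    worth (toℕ l) (g ℕ.+ r) i ≡ worth (toℕ l) r (finish l)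
  worth-constant l zero    _   refl _  = refl
  worth-constant l (suc g) {r} {i} s≤i g+i≡f eq = begin
    worth (toℕ l) (suc (g ℕ.+ r)) i
      ≡⟨ cong (value (toℕ l) (suc (g ℕ.+ r)) i)
           (successes-suc (g ℕ.+ r) (ℕ.m≤n⇒m≤1+n l≤i) (accept l s≤i i<f) (reject l i<f)) ⟩
    value (toℕ l) (suc (g ℕ.+ r)) i
      (topCompletions (suc (g ℕ.+ r)) (suc i) (toℕ l) ℕ.+ (suc i ∸ toℕ l) ℕ.* unselected (g ℕ.+ r) (suc i))
      ≡⟨ value-suc (toℕ l) (unselected (g ℕ.+ r) (suc i)) l≤i (cong suc (trans (ℕ.+-comm i (suc (g ℕ.+ r))) eq)) ⟩
    worth (toℕ l) (g ℕ.+ r) (suc i)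
      ≡⟨ worth-constant l g (ℕ.m≤n⇒m≤1+n s≤i) (trans (ℕ.+-suc g i) g+i≡f) (trans (ℕ.+-suc (g ℕ.+ r) i) eq) ⟩
    worth (toℕ l) r (finish l) ∎
    where
    l≤i = ℕ.≤-trans (toℕ≤start l) s≤i
    i<f = subst (i <_) g+i≡f (s≤s (ℕ.m≤n+m i g))

  e : Fin (suc k) → ℚ
  e l = worth (toℕ l) (m ∸ start l) (start l)

  e-finish : ∀ l → e l ≡ worth (toℕ l) (m ∸ finish l) (finish l)
  e-finish l = trans (cong (λ r → worth (toℕ l) r (start l)) (sym split))
    (worth-constant l (finish l ∸ start l) ℕ.≤-refl (ℕ.m∸n+n≡m (start≤finish l))
      (trans (cong (ℕ._+ start l) split) (ℕ.m∸n+n≡m (ℕ.≤-trans (start≤finish l) (finish≤m l)))))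
    where
    split : finish l ∸ start l ℕ.+ (m ∸ finish l) ≡ m ∸ start l
    split = begin
      finish l ∸ start l ℕ.+ (m ∸ finish l)   ≡⟨ ℕ.+-comm (finish l ∸ start l) (m ∸ finish l) ⟩
      m ∸ finish l ℕ.+ (finish l ∸ start l)   ≡⟨ ℕ.+-∸-assoc (m ∸ finish l) (start≤finish l) ⟨
      m ∸ finish l ℕ.+ finish l ∸ start l     ≡⟨ cong (_∸ start l) (ℕ.m∸n+n≡m (finish≤m l)) ⟩
      m ∸ start l                             ∎

  -- One stretch ends where the next begins, so the two potentials are compared at the same i and
  -- the same success count.
  e-step : ∀ i → e (inject₁ i) ≡ ι (t k<n s i) * e (suc i) - d k<n (toℕ i) (t k<n s i)
  e-step i = begin
    e (inject₁ i)
      ≡⟨ e-finish (inject₁ i) ⟩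
    worth (toℕ (inject₁ i)) (m ∸ finish (inject₁ i)) (finish (inject₁ i))
      ≡⟨ cong₂ (λ l a → worth l (m ∸ a) a) (Fin.toℕ-inject₁ i) (lookup-∷ʳ-inject₁ s m i) ⟩
    worth (toℕ i) (m ∸ a) a
      ≡⟨ value-switch (toℕ i) (unselected (m ∸ a) a) (Fin.toℕ<n i) (proj₁ (s-bounds i))
           (trans (ℕ.+-suc a (m ∸ a)) (cong suc (ℕ.m+[n∸m]≡n (s≤m i)))) ⟩
    ι (t k<n s i) * e (suc i) - d k<n (toℕ i) (t k<n s i) ∎
    where a = lookup s i

  e-end : e (fromℕ k) ≡ - δ k<n
  e-end = begin
    e (fromℕ k)
      ≡⟨ e-finish (fromℕ k) ⟩
    worth (toℕ (fromℕ k)) (m ∸ finish (fromℕ k)) (finish (fromℕ k))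
      ≡⟨ cong₂ (λ l a → worth l (m ∸ a) a) (Fin.toℕ-fromℕ k) (lookup-∷ʳ-fromℕ s m) ⟩
    worth k (m ∸ m) m
      ≡⟨ cong (λ r → worth k r m) (ℕ.n∸n≡0 m) ⟩
    worth k 0 m
      ≡⟨ cong (value k 0 m) (successes-end (s≤s⁻¹ k<n)) ⟩
    value k 0 m k
      ≡⟨ value-end k′ y k<n ⟩
    - δ k<n ∎

  successProbability≡e : successProbability k<n s ≡ e zero
  successProbability≡e = trans (successProbability≡successes k<n s) (tidy (ι (unselected m 0)) N⁻)
    where
    tidy : ∀ u N → u * N ≡ 1ℚ * u * N + 0ℚ
    tidy = solve-∀ ℚ-ring

theorem3 : (n k : ℕ) → 1 ≤ k → (k<n : k < n) (s : Vec ℕ k) →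
    (∀ (i j : Fin k) → i Fin.≤ j → lookup s i ≤ lookup s j) →
    (∀ (i : Fin k) → suc (toℕ i) ≤ lookup s i × lookup s i < n) →
    successProbability k<n s ≡
    - ∑ (λ (i : Fin k) →
    ι (∏ (λ (j : Fin (toℕ i)) → t k<n s (inject {i = i} j))) * d k<n (toℕ i) (t k<n s i))
    - ι (∏ (t k<n s)) * δ k<n
theorem3 n (suc k′) _ k<n = shifted (n ∸ 2+ k′) (trans (cong suc (ℕ.+-suc k′ (n ∸ 2+ k′))) (ℕ.m+[n∸m]≡n k<n)) k<n
  where
  -- With n = k + 1 + y the quantities k - 1, n - k and n - 1 are constructor expressions and need
  -- no truncated subtraction.
  shifted : ∀ y {n} → suc (k′ ℕ.+ suc y) ≡ n → (k<n : suc k′ < n) (s : Vec ℕ (suc k′)) →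
    (∀ (i j : Fin (suc k′)) → i Fin.≤ j → lookup s i ≤ lookup s j) →
    (∀ (i : Fin (suc k′)) → suc (toℕ i) ≤ lookup s i × lookup s i < n) →
    successProbability k<n s ≡
    - ∑ (λ (i : Fin (suc k′)) →
    ι (∏ (λ (j : Fin (toℕ i)) → t k<n s (inject {i = i} j))) * d k<n (toℕ i) (t k<n s i))
    - ι (∏ (t k<n s)) * δ k<n
  shifted y refl k<n s s-mono s-bounds =
    trans successProbability≡e (unroll (suc k′) (t k<n s) _ e e-step e-end)
    where open Policy k′ y k<n s s-mono s-bounds
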